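{- Let $n \geq 4$ be an integer and let $\beta_{n-1} \in S_n$ be any $(n-1)$-cycle. Then for every integer $k$ with $0\le k\le n$, \[ c(k, \beta_{n-1})=(n-1)\binom{n-1}{k}C(k)+(n-1)^2\binom{n-3}{k-3}S(k-2). \]
   Context: $S_n$ is the group of permutations of $[n]=\{1,\dots,n\}$; products are composed right to left. The Hamming distance between $\sigma,\tau\in S_n$ is $H(\sigma,\tau)=|\{a\in[n]:\sigma(a)\neq\tau(a)\}|$. Two permutations $\alpha,\beta\in S_n$ $k$-commute if $H(\alpha\beta,\beta\alpha)=k$; $c(k,\beta)$ denotes the number of $\alpha\in S_n$ that $k$-commute with $\beta$. An $(n-1)$-cycle in $S_n$ is a permutation consisting of one cycle of length $n-1$ and one fixed point. For a permutation $\pi=p_1\dots p_j$ of $[j]$ in one-line notation, a succession is an index $i$ with $1\le i\le j-1$ and $p_{i+1}=p_i+1$; $S(j)$ denotes the number of permutations of $[j]$ with no succession (so $S(0)=S(1)=S(2)=1$). $C(k)$ denotes the number of cyclic permutations ($k$-cycles) $\sigma$ of $\{1,\dots,k\}$ such that $\sigma(i)\neq i+1 \bmod k$ for all $i$, using the convention $k \bmod k = k$; this is OEIS sequence A000757, with $C(0)=1$, $C(1)=C(2)=0$, $C(3)=1$. Binomial coefficients $\binom{a}{b}$ are $0$ when $b<0$ or $b>a$. -}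

module Defs where

open import Data.Nat using (ℕ; zero; suc; _+_; _*_; _∸_; _^_; _≤_; _<_)
open import Data.Nat.Combinatorics using (_C_)
open import Data.Integer using (ℤ; +_; -[1+_])
open import Data.Fin using (Fin; toℕ) renaming (zero to fzero; suc to fsuc)
open import Data.Fin.Properties using (all?; any?) renaming (_≟_ to _≟ᶠ_)
open import Data.List using (List; []; _∷_; [_]; map; concatMap; filter; length)
open import Data.List.Base using (allFin)
open import Data.Product using (Σ; ∃; _×_)
open import Function using (_∘_; id)
open import Relation.Nullary using (¬_; Dec; ¬?)
open import Relation.Nullary.Decidable using (_×-dec_; _→-dec_)
import Data.Nat.Properties as ℕP
open import Relation.Binary.PropositionalEquality using (_≡_; _≢_)

-- Finite enumeration of all functions [n] → [m]  (Fin n → Fin m),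
-- each function occurring exactly once (up to pointwise equality).

cons : ∀ {n m} → Fin m → (Fin n → Fin m) → Fin (suc n) → Fin m
cons b f fzero    = b
cons b f (fsuc i) = f i

allFuns : ∀ n m → List (Fin n → Fin m)
allFuns zero    m = [ (λ ()) ]
allFuns (suc n) m = concatMap (λ f → map (λ b → cons b f) (allFin m)) (allFuns n m)

countFuns : ∀ n {P : (Fin n → Fin n) → Set} → ((f : Fin n → Fin n) → Dec (P f)) → ℕ
countFuns n P? = length (filter P? (allFuns n n))

IsPerm : ∀ {n} → (Fin n → Fin n) → Set
IsPerm {n} f = (i j : Fin n) → f i ≡ f j → i ≡ j

isPerm? : ∀ {n} (f : Fin n → Fin n) → Dec (IsPerm f)
isPerm? f = all? (λ i → all? (λ j → (f i ≟ᶠ f j) →-dec (i ≟ᶠ j)))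

iter : ∀ {n} → (Fin n → Fin n) → ℕ → Fin n → Fin n
iter f zero    = id
iter f (suc j) = f ∘ iter f j

hamming : ∀ {n} → (Fin n → Fin n) → (Fin n → Fin n) → ℕ
hamming {n} σ τ = length (filter (λ a → ¬? (σ a ≟ᶠ τ a)) (allFin n))

KCommute : ∀ {n} → ℕ → (Fin n → Fin n) → (Fin n → Fin n) → Set
KCommute k α β = hamming (α ∘ β) (β ∘ α) ≡ k

c : ∀ {n} → ℕ → (Fin n → Fin n) → ℕ
c {n} k β = countFuns n (λ α → isPerm? α ×-dec (hamming (α ∘ β) (β ∘ α) ℕP.≟ k))

-- (n-1)-cycles: a permutation with a fixed point p such that the orbit
-- of some point x contains every point different from p
-- (so the non-fixed part is a single cycle of length n-1).

IsNm1Cycle : ∀ {n} → (Fin n → Fin n) → Set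
IsNm1Cycle {n} β =
  Σ (Fin n) λ p → (β p ≡ p) × (Σ (Fin n) λ x → (y : Fin n) → y ≢ p → ∃ λ j → iter β j x ≡ y)

NoSuccession : ∀ {j} → (Fin j → Fin j) → Set
NoSuccession {j} π =
  (i i′ : Fin j) → toℕ i′ ≡ suc (toℕ i) → toℕ (π i′) ≢ suc (toℕ (π i))

noSuccession? : ∀ {j} (π : Fin j → Fin j) → Dec (NoSuccession π)
noSuccession? π = all? (λ i → all? (λ i′ →
  (toℕ i′ ℕP.≟ suc (toℕ i)) →-dec ¬? (toℕ (π i′) ℕP.≟ suc (toℕ (π i)))))

Snum : ℕ → ℕ
Snum j = countFuns j (λ π → isPerm? π ×-dec noSuccession? π)

-- Cyclic permutations of [k]: a single orbit containing every point.
-- (For a permutation of k points, every orbit point is reached within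
-- fewer than k steps, so the iterate count is taken in Fin k.)
-- For k = 0 this holds vacuously (the empty permutation), matching C(0)=1.

IsCyclic : ∀ {k} → (Fin k → Fin k) → Set
IsCyclic {k} σ = (x y : Fin k) → ∃ λ (t : Fin k) → iter σ (toℕ t) x ≡ y

isCyclic? : ∀ {k} (σ : Fin k → Fin k) → Dec (IsCyclic σ)
isCyclic? σ = all? (λ x → all? (λ y → any? (λ t → iter σ (toℕ t) x ≟ᶠ y)))

-- σ(i) ≠ i+1 mod k  (with k mod k = k); 0-based: σ(i) ≠ (i+1) mod k
NoCyclicSucc : ∀ {k} → (Fin k → Fin k) → Set
NoCyclicSucc {k} σ = (i : Fin k) →
  (toℕ (σ i) ≢ suc (toℕ i)) × (suc (toℕ i) ≡ k → toℕ (σ i) ≢ 0)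

noCyclicSucc? : ∀ {k} (σ : Fin k → Fin k) → Dec (NoCyclicSucc σ)
noCyclicSucc? {k} σ = all? (λ i →
  ¬? (toℕ (σ i) ℕP.≟ suc (toℕ i)) ×-dec
  ((suc (toℕ i) ℕP.≟ k) →-dec ¬? (toℕ (σ i) ℕP.≟ 0)))

-- C(k) (OEIS A000757)
Cnum : ℕ → ℕ
Cnum k = countFuns k (λ σ → (isPerm? σ ×-dec isCyclic? σ) ×-dec noCyclicSucc? σ)

-- Binomial coefficient with integer lower index: 0 when b < 0
-- (and stdlib's _C_ already gives 0 when b > a).

binom : ℕ → ℤ → ℕ
binom a (+ b)    = a C b
binom a -[1+ _ ] = 0

{-# OPTIONS --safe #-}

-- Identify the points with Maybe (Fin m), m = n - 1, so that the fixed point of β is nothing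
-- and β is the successor of ℤ/m on the rest; call a point x good for α when α (β x) ≡ β (α x).  Let Z(m, g)
-- be the number of permutations α with exactly g = n - k good points, those with α nothing ≡ nothing
-- and those with α nothing ≢ nothing being treated separately.  Let Z⁰(m, g) be the number of these
-- that moreover fix 0.  Two double counts, each using that composing α on either side with powers of
-- β preserves goodness, give
--   (number of a ≢ nothing with α a ≢ nothing) * Z(m, g) = m² Z⁰(m, g),
--   (number of good points a ≢ nothing) * Z(m, g) = m² * #{α : α fixes 0 and 0 is good},
-- and deleting the point 0 identifies the last set with the one counted by Z⁰(m - 1, g - 1).
-- Eliminating Z⁰ leaves a one-term recurrence along which k is constant, solved by a binomial
-- coefficient times the value at the smallest m.  There every point that can be bad is bad, so α is a
-- cyclic permutation without cyclic succession (σ = α β α⁻¹) in the first case and, after a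
-- rotation, a permutation without succession in the second (where the count is 0 for k ≤ 2).

module Submission where

open import Defs
open import Data.Nat using (ℕ; _+_; _*_; _∸_; _^_; _≤_)
open import Data.Nat.Combinatorics using (_C_)
open import Data.Integer using (+_) renaming (_-_ to _-ℤ_)
open import Data.Fin using (Fin)
open import Relation.Binary.PropositionalEquality using (_≡_)

open import Level using (0ℓ)
open import Data.Bool using (Bool; true; false)
open import Data.Nat using (zero; suc; z≤n; s≤s; NonZero)
import Data.Nat as ℕ
import Data.Nat.Properties as ℕ
open import Data.Nat.Combinatorics
  using (nCk+nC[k+1]≡[n+1]C[k+1]; nC1≡n; k>n⇒nCk≡0; nCk≡nC[n∸k])
open import Data.Nat.DivMod using (_%_; _/_; m≡m%n+[m/n]*n; m%n<n)
open import Data.Nat.Tactic.RingSolver using (solve-∀)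
open import Data.Fin
  using (zero; suc; toℕ; fromℕ<; punchIn; punchOut; combine; remQuot; splitAt; join; _↑ˡ_; _↑ʳ_)
import Data.Fin.Properties as Fin
open import Data.List
  using ([]; _∷_; _++_; map; concatMap; cartesianProductWith; filter; length; lookup; allFin)
open import Data.List.Relation.Unary.All as All using (All; []; _∷_)
open import Data.List.Relation.Unary.All.Properties using (all-filter)
open import Data.List.Relation.Unary.Any as Any using (Any; here)
open import Data.List.Relation.Unary.Any.Properties using (lookup-index)
open import Data.List.Relation.Unary.AllPairs using ([]; _∷_)
open import Data.List.Relation.Unary.Unique.Setoid using (Unique)
import Data.List.Relation.Unary.Unique.Setoid.Properties as Unique
import Data.List.Relation.Unary.Unique.Propositional.Properties as Unique≡
import Data.List.Membership.Setoid.Properties as Membership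
import Data.List.Membership.Propositional.Properties as Membership≡
open import Data.Maybe as Maybe using (Maybe; just; nothing; fromMaybe)
import Data.Maybe.Properties as Maybe
open import Data.Product using (∃; ∃₂; _×_; _,_; proj₁; proj₂; uncurry)
open import Data.Product.Relation.Binary.Pointwise.NonDependent using (_×ₛ_)
open import Data.Sum as Sum using (_⊎_; inj₁; inj₂)
open import Data.Unit using (⊤; tt)
open import Function using (_∘_; id; Injective)
open import Relation.Nullary using (¬_; Dec; yes; no; ¬?; contradiction)
import Relation.Nullary.Decidable as Dec
open import Relation.Nullary.Decidable using (_×-dec_; _→-dec_)
open import Relation.Unary using (Decidable)
open import Relation.Binary.Bundles using (Setoid)
open import Relation.Binary.Definitions using (_Respects_; DecidableEquality)
open import Relation.Binary.PropositionalEquality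
  using (_≢_; _≗_; refl; sym; trans; cong; cong₂; subst; setoid; _→-setoid_; module ≡-Reasoning)

open ≡-Reasoning

open Setoid using (Carrier)

-- Counting

-- Without function extensionality, counting functions means counting them up to _≗_; hence the setoid.
record Card (S : Setoid 0ℓ 0ℓ) (P : Carrier S → Set) (k : ℕ) : Set where
  open Setoid S using (_≈_)
  field
    at       : Fin k → Carrier S
    sound    : ∀ i → P (at i)
    distinct : ∀ {i j} → at i ≈ at j → i ≡ j
    index    : ∀ {x} → P x → Fin k
    at-index : ∀ {x} (p : P x) → at (index p) ≈ x

open Card

module _ (S : Setoid 0ℓ 0ℓ) where
  open Setoid S using (_≈_) renaming (sym to ≈sym; trans to ≈trans; refl to ≈refl)

  card-≤ : ∀ {P Q k l} → Card S P k → Card S Q l → (∀ {x} → P x → Q x) → k ≤ l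
  card-≤ {k = k} {l} c d P⇒Q = Fin.injective⇒≤ {f = f} λ {i} {j} eq →
    distinct c (≈trans (≈sym (at-index d (q i)))
      (≈trans (subst (λ z → at d (f i) ≈ at d z) eq ≈refl) (at-index d (q j))))
    where
    q = λ i → P⇒Q (sound c i)
    f : Fin k → Fin l
    f i = index d (q i)

  card-unique : ∀ {P k l} → Card S P k → Card S P l → k ≡ l
  card-unique c d = ℕ.≤-antisym (card-≤ c d id) (card-≤ d c id)

  card-⇔ : ∀ {P Q k} → (∀ {x} → P x → Q x) → (∀ {x} → Q x → P x) → Card S P k → Card S Q k
  card-⇔ P⇒Q Q⇒P c = record
    { at = at c ; sound = P⇒Q ∘ sound c ; distinct = distinct c
    ; index = index c ∘ Q⇒P ; at-index = at-index c ∘ Q⇒P }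

  card-∅ : ∀ {P} → (∀ {x} → ¬ P x) → Card S P 0
  card-∅ ¬P = record
    { at = λ () ; sound = λ () ; distinct = λ { {()} }
    ; index = λ p → contradiction p ¬P ; at-index = λ p → contradiction p ¬P }

  card-0 : ∀ {P} → Card S P 0 → ∀ {x} → ¬ P x
  card-0 c p with () ← index c p

  card-singleton : ∀ {P x} → P x → (∀ {y} → P y → x ≈ y) → Card S P 1
  card-singleton {x = x} p u = record
    { at = λ _ → x ; sound = λ _ → p ; distinct = λ { {zero} {zero} _ → refl }
    ; index = λ _ → zero ; at-index = u }

  card-1 : ∀ {P x y} → Card S P 1 → P x → P y → x ≈ y
  card-1 c p q with index c p | at-index c p | index c q | at-index c q
  ... | zero | e | zero | e′ = ≈trans (≈sym e) e′

  card-⊎ : ∀ {P Q k l} → Card S P k → Card S Q l → (∀ {x y} → P x → Q y → ¬ x ≈ y) →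
           Card S (λ x → P x ⊎ Q x) (k + l)
  card-⊎ {P} {Q} {k} {l} c d disj = record
    { at = at′ ∘ splitAt k
    ; sound = sound′ ∘ splitAt k
    ; distinct = λ {i} {j} eq → trans (sym (Fin.join-splitAt k l i))
        (trans (cong (join k l) (distinct′ (splitAt k i) (splitAt k j) eq)) (Fin.join-splitAt k l j))
    ; index = index′
    ; at-index = λ { (inj₁ p) → subst (λ s → at′ s ≈ _) (sym (Fin.splitAt-↑ˡ k (index c p) l)) (at-index c p)
                   ; (inj₂ q) → subst (λ s → at′ s ≈ _) (sym (Fin.splitAt-↑ʳ k l (index d q))) (at-index d q) }
    }
    where
    at′ : Fin k ⊎ Fin l → Carrier S
    at′ (inj₁ i) = at c i
    at′ (inj₂ j) = at d j
    sound′ : ∀ s → P (at′ s) ⊎ Q (at′ s)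
    sound′ (inj₁ i) = inj₁ (sound c i)
    sound′ (inj₂ j) = inj₂ (sound d j)
    distinct′ : ∀ s t → at′ s ≈ at′ t → s ≡ t
    distinct′ (inj₁ i) (inj₁ j) eq = cong inj₁ (distinct c eq)
    distinct′ (inj₁ i) (inj₂ j) eq = contradiction eq (disj (sound c i) (sound d j))
    distinct′ (inj₂ i) (inj₁ j) eq = contradiction (≈sym eq) (disj (sound c j) (sound d i))
    distinct′ (inj₂ i) (inj₂ j) eq = cong inj₂ (distinct d eq)
    index′ : ∀ {x} → P x ⊎ Q x → Fin (k + l)
    index′ (inj₁ p) = index c p ↑ˡ l
    index′ (inj₂ q) = k ↑ʳ index d q

  private
    lookup-distinct : ∀ {xs} → Unique S xs → ∀ {i j} → lookup xs i ≈ lookup xs j → i ≡ j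
    lookup-distinct (_ ∷ _) {zero} {zero} _ = refl
    lookup-distinct (x# ∷ _) {zero} {suc j} eq = contradiction eq (All.lookup x# (Membership≡.∈-lookup j))
    lookup-distinct (x# ∷ _) {suc i} {zero} eq = contradiction (≈sym eq) (All.lookup x# (Membership≡.∈-lookup i))
    lookup-distinct (_ ∷ u) {suc i} {suc j} eq = cong suc (lookup-distinct u eq)

  card-list : ∀ {P xs} → Unique S xs → All P xs → (∀ {x} → P x → Any (x ≈_) xs) →
              Card S P (length xs)
  card-list {xs = xs} u s complete = record
    { at = lookup xs
    ; sound = λ i → All.lookup s (Membership≡.∈-lookup i)
    ; distinct = lookup-distinct u
    ; index = Any.index ∘ complete
    ; at-index = ≈sym ∘ lookup-index ∘ complete }

  card-filter-list : ∀ {P xs} (P? : Decidable P) → P Respects _≈_ → Unique S xs →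
                     (∀ x → Any (x ≈_) xs) → Card S P (length (filter P? xs))
  card-filter-list {xs = xs} P? resp u complete = card-list (Unique.filter⁺ S P? u) (all-filter P? xs)
    (λ {x} p → Membership.∈-filter⁺ S P? resp (complete x) p)

card-bij : ∀ {S T P Q k} →
           let open Setoid S using () renaming (_≈_ to _≈₁_)
               open Setoid T using () renaming (_≈_ to _≈₂_) in
           (f : Carrier S → Carrier T) (g : Carrier T → Carrier S) →
           (∀ {x x′} → x ≈₁ x′ → f x ≈₂ f x′) → (∀ {y y′} → y ≈₂ y′ → g y ≈₁ g y′) →
           (∀ {x} → P x → Q (f x)) → (∀ {y} → Q y → P (g y)) →
           (∀ {x} → P x → g (f x) ≈₁ x) → (∀ {y} → Q y → f (g y) ≈₂ y) →
           Card S P k → Card T Q k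
card-bij {S} {T} f g f-cong g-cong to from gf fg c = record
  { at = f ∘ at c
  ; sound = to ∘ sound c
  ; distinct = λ {i} {j} eq → distinct c
      (S.trans (S.sym (gf (sound c i))) (S.trans (g-cong eq) (gf (sound c j))))
  ; index = index c ∘ from
  ; at-index = λ q → T.trans (f-cong (at-index c (from q))) (fg q) }
  where
  module S = Setoid S
  module T = Setoid T

-- Serves where a preimage can only be built from a proof of `Q y`, so that `card-bij`, which takes
-- an inverse map on the whole carrier, does not apply.
card-image : ∀ {S T P Q k} →
             let open Setoid S using () renaming (_≈_ to _≈₁_)
                 open Setoid T using () renaming (_≈_ to _≈₂_) in
             (f : Carrier S → Carrier T) → (∀ {x x′} → x ≈₁ x′ → f x ≈₂ f x′) →
             (∀ {x} → P x → Q (f x)) →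
             (∀ {x x′} → P x → P x′ → f x ≈₂ f x′ → x ≈₁ x′) →
             (∀ {y} → Q y → ∃ λ x → P x × f x ≈₂ y) →
             Card S P k → Card T Q k
card-image {T = T} f f-cong P⇒Q inj surj c = record
  { at = f ∘ at c
  ; sound = P⇒Q ∘ sound c
  ; distinct = distinct c ∘ inj (sound c _) (sound c _)
  ; index = λ q → index c (proj₁ (proj₂ (surj q)))
  ; at-index = λ q → let x , p , e = surj q in Setoid.trans T (f-cong (at-index c p)) e }

-- All fibres have the same size `l`, so pairs are indexed by `Fin k × Fin l`. The fibre over `x` is
-- enumerated over the listed representative of `x`, and `resp` moves `Q` there.
card-Σ : ∀ {S T P k l} {Q : Carrier S → Carrier T → Set} →
         (∀ {x x′ y} → Setoid._≈_ S x x′ → Q x y → Q x′ y) →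
         Card S P k → (∀ {x} → P x → Card T (Q x) l) →
         Card (S ×ₛ T) (λ (x , y) → P x × Q x y) (k * l)
card-Σ {S} {T} {P} {k} {l} {Q} resp c d = record
  { at = at′ ∘ remQuot l
  ; sound = λ i → sound c _ , sound (d′ _) _
  ; distinct = λ {i} {j} eq → trans (sym (Fin.combine-remQuot {k} l i))
      (trans (cong (uncurry combine) (distinct′ (remQuot {k} l i) (remQuot {k} l j) eq)) (Fin.combine-remQuot {k} l j))
  ; index = λ (p , q) → combine (index c p) (index (d′ (index c p)) (q′ p q))
  ; at-index = λ (p , q) → subst (λ s → Setoid._≈_ (S ×ₛ T) (at′ s) _)
      (sym (Fin.remQuot-combine (index c p) _)) (at-index c p , at-index (d′ _) (q′ p q)) }
  where
  d′ : ∀ i → Card T (Q (at c i)) l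
  d′ i = d (sound c i)
  q′ : ∀ {x y} (p : P x) → Q x y → Q (at c (index c p)) y
  q′ p = resp (Setoid.sym S (at-index c p))
  at′ : Fin k × Fin l → Carrier (S ×ₛ T)
  at′ (i , j) = at c i , at (d′ i) j
  distinct′ : ∀ s t → Setoid._≈_ (S ×ₛ T) (at′ s) (at′ t) → s ≡ t
  distinct′ (i , j) (i′ , j′) (eq , eq′) with refl ← distinct c eq = cong (i ,_) (distinct (d′ i) eq′)

-- The relation `R`, as a set of pairs, is enumerated once by rows and once by columns; swapping the
-- components identifies the two enumerations.
double-count : ∀ {S T P Q z g N t} {R : Carrier S → Carrier T → Set} →
               (∀ {x x′ y} → Setoid._≈_ S x x′ → R x y → R x′ y) →
               (∀ {x y y′} → Setoid._≈_ T y y′ → R x y → R x y′) →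
               (∀ {x y} → R x y → P x × Q y) →
               Card S P z → (∀ {x} → P x → Card T (R x) g) →
               Card T Q N → (∀ {y} → Q y → Card S (λ x → R x y) t) →
               z * g ≡ N * t
double-count {S} {T} respˡ respʳ R⇒PQ cP cR cQ cR′ = card-unique (S ×ₛ T) (card-Σ respˡ cP cR)
  (card-bij {S = T ×ₛ S} (λ (y , x) → x , y) (λ (x , y) → y , x)
    (λ (e , e′) → e′ , e) (λ (e , e′) → e′ , e)
    (λ (q , r) → proj₁ (R⇒PQ r) , r) (λ (p , r) → proj₂ (R⇒PQ r) , r)
    (λ _ → Setoid.refl (T ×ₛ S)) (λ _ → Setoid.refl (S ×ₛ T))
    (card-Σ {S = T} {T = S} respʳ cQ cR′))

card-Fin : ∀ k → Card (setoid (Fin k)) (λ _ → ⊤) k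
card-Fin k = record { at = id ; sound = λ _ → tt ; distinct = id ; index = λ {x} _ → x ; at-index = λ _ → refl }

card-Fin? : ∀ {k P} (P? : Decidable P) → Card (setoid (Fin k)) P (length (filter P? (allFin k)))
card-Fin? {k} P? = card-filter-list (setoid (Fin k)) P? (λ { refl p → p })
  (Unique≡.allFin⁺ k) Membership≡.∈-allFin

-- The indices are filtered, so `Q` is decided on the listed representatives only; as `Q` respects
-- the equivalence, this settles it for every element.
card-filter : ∀ {S P k} {Q : Carrier S → Set} → Card S P k → Q Respects (Setoid._≈_ S) →
              (∀ {x} → P x → Dec (Q x)) → ∃ (Card S (λ x → P x × Q x))
card-filter {S} {P} {k} {Q} c resp Q? = _ , record
  { at = at c ∘ at d
  ; sound = λ i → sound c (at d i) , sound d i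
  ; distinct = distinct d ∘ distinct c
  ; index = λ (p , q) → index d (q′ p q)
  ; at-index = λ (p , q) → Setoid.trans S
      (subst (λ i → Setoid._≈_ S (at c (at d (index d (q′ p q)))) (at c i)) (at-index d (q′ p q)) (Setoid.refl S))
      (at-index c p) }
  where
  d = card-Fin? (λ i → Q? (sound c i))
  q′ : ∀ {x} (p : P x) → Q x → Q (at c (index c p))
  q′ p = resp (Setoid.sym S (at-index c p))

card-split : ∀ {S P k} {Q : Carrier S → Set} → Card S P k → Q Respects (Setoid._≈_ S) →
             (∀ {x} → P x → Dec (Q x)) →
             ∃₂ λ l m → Card S (λ x → P x × Q x) l × Card S (λ x → P x × ¬ Q x) m × k ≡ l + m
card-split {S} c resp Q? = l , m , cl , cm , card-unique S c (card-⇔ S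
    (λ { (inj₁ (p , _)) → p ; (inj₂ (p , _)) → p })
    (λ p → Sum.map (p ,_) (p ,_) (Dec.toSum (Q? p)))
    (card-⊎ S cl cm (λ { (_ , q) (_ , ¬q) e → ¬q (resp e q) })))
  where
  r = card-filter c resp Q?
  r′ = card-filter c (λ e ¬q q → ¬q (resp (Setoid.sym S e) q)) (¬? ∘ Q?)
  l = proj₁ r
  cl = proj₂ r
  m = proj₁ r′
  cm = proj₂ r′

-- Self-maps of finite sets

-- If `y` were missed, punching it out would turn `f` into an injection from `Fin (suc n)` into
-- `Fin n`.
Fin-injective⇒surjective : ∀ {n} {f : Fin n → Fin n} → Injective _≡_ _≡_ f → ∀ y → ∃ λ x → f x ≡ y
Fin-injective⇒surjective {suc n} {f} inj y with Fin.any? (λ x → f x Fin.≟ y)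
... | yes r = r
... | no ¬r = contradiction (Fin.injective⇒≤ (inj ∘ Fin.punchOut-injective (y≢ _) (y≢ _))) ℕ.1+n≰n
  where
  y≢ : ∀ x → y ≢ f x
  y≢ x eq = ¬r (x , sym eq)

module _ {X : Set} {k : ℕ} (c : Card (setoid X) (λ _ → ⊤) k) where

  injective⇒surjective : ∀ {f : X → X} → Injective _≡_ _≡_ f → ∀ y → ∃ λ x → f x ≡ y
  injective⇒surjective {f} inj y =
    let i , eq = Fin-injective⇒surjective
          {f = λ i → index c {f (at c i)} tt}
          (λ {i} {j} eq → distinct c (inj (trans (sym (at-index c tt)) (trans (cong (at c) eq) (at-index c tt)))))
          (index c {y} tt)
    in at c i , trans (sym (at-index c tt)) (trans (cong (at c) eq) (at-index c tt))

  -- A section of `f` is injective, hence surjective; so every `x` is a value of the section and is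
  -- recovered from `f x`.
  surjective⇒injective : ∀ {f : X → X} → (∀ y → ∃ λ x → f x ≡ y) → Injective _≡_ _≡_ f
  surjective⇒injective {f} surj {x} {x′} eq =
    let y , sy = injective⇒surjective s-inj x
        y′ , sy′ = injective⇒surjective s-inj x′
    in trans (sym sy) (trans (cong (proj₁ ∘ surj)
         (trans (sym (proj₂ (surj y))) (trans (cong f sy) (trans eq (trans (sym (cong f sy′)) (proj₂ (surj y′)))))))
         sy′)
    where
    s-inj : Injective _≡_ _≡_ (proj₁ ∘ surj)
    s-inj {y} {y′} e = trans (sym (proj₂ (surj y))) (trans (cong f e) (proj₂ (surj y′)))

-- Conjugation and good points

Inj : ∀ {X : Set} → (X → X) → Set
Inj = Injective _≡_ _≡_

inj-resp : ∀ {X : Set} {α α′ : X → X} → α ≗ α′ → Inj α → Inj α′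
inj-resp e inj eq = inj (trans (e _) (trans eq (sym (e _))))

-- An isomorphism of sets with a self-map. For equal self-maps it is an invertible element of the
-- centraliser of `β`.
record Iso {X Y : Set} (β : X → X) (β′ : Y → Y) : Set where
  field
    to       : X → Y
    from     : Y → X
    from-to  : ∀ x → from (to x) ≡ x
    to-from  : ∀ y → to (from y) ≡ y
    commutes : ∀ x → to (β x) ≡ β′ (to x)

  to-injective : ∀ {x x′} → to x ≡ to x′ → x ≡ x′
  to-injective e = trans (sym (from-to _)) (trans (cong from e) (from-to _))

  from-injective : ∀ {y y′} → from y ≡ from y′ → y ≡ y′
  from-injective e = trans (sym (to-from _)) (trans (cong to e) (to-from _))

open Iso

Iso-sym : ∀ {X Y β β′} → Iso {X} {Y} β β′ → Iso β′ β
Iso-sym {β = β} {β′} s = record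
  { to = from s ; from = to s ; from-to = to-from s ; to-from = from-to s
  ; commutes = λ y → to-injective s (begin
      to s (from s (β′ y))   ≡⟨ to-from s _ ⟩
      β′ y                   ≡⟨ cong β′ (to-from s y) ⟨
      β′ (to s (from s y))   ≡⟨ commutes s _ ⟨
      to s (β (from s y))    ∎) }

Good : ∀ {X : Set} → (X → X) → (X → X) → X → Set
Good β α x = α (β x) ≡ β (α x)

Goods : ∀ {X : Set} → (X → X) → (X → X) → ℕ → Set
Goods {X} β α g = Card (setoid X) (Good β α) g

good-resp : ∀ {X : Set} {β α α′ : X → X} {x} → α ≗ α′ → Good β α x → Good β α′ x
good-resp {β = β} e p = trans (sym (e _)) (trans p (cong β (e _)))

goods-resp : ∀ {X : Set} {β α α′ : X → X} {g} → α ≗ α′ → Goods β α g → Goods β α′ g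
goods-resp {X} {β} {α} {α′} e = card-⇔ (setoid X) (λ {x} → good-resp {β = β} {α} {α′} e)
  (λ {x} → good-resp {β = β} {α′} {α} (sym ∘ e))

-- The target is relabelled by `s` and the source by `t`, which may differ: each commutes with the
-- self-maps, and this is enough to preserve goodness.
conj : ∀ {X Y β β′} → Iso {X} {Y} β β′ → Iso β β′ → (X → X) → Y → Y
conj s t α = to s ∘ α ∘ from t

module _ {X Y : Set} {β : X → X} {β′ : Y → Y} (s t : Iso β β′) where

  conj-injective : ∀ {α} → Inj α → Inj (conj s t α)
  conj-injective inj = from-injective t ∘ inj ∘ to-injective s

  conj-conj : ∀ α → conj (Iso-sym s) (Iso-sym t) (conj s t α) ≗ α
  conj-conj α x = trans (from-to s _) (cong α (from-to t x))

  good-conj : ∀ {α x} → Good β α x → Good β′ (conj s t α) (to t x)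
  good-conj {α} {x} p = begin
    to s (α (from t (β′ (to t x))))  ≡⟨ cong (to s ∘ α) (commutes (Iso-sym t) _) ⟩
    to s (α (β (from t (to t x))))   ≡⟨ cong (to s ∘ α ∘ β) (from-to t x) ⟩
    to s (α (β x))                   ≡⟨ cong (to s) p ⟩
    to s (β (α x))                   ≡⟨ commutes s _ ⟩
    β′ (to s (α x))                  ≡⟨ cong (β′ ∘ to s ∘ α) (from-to t x) ⟨
    β′ (to s (α (from t (to t x))))  ∎

module _ {X Y : Set} {β : X → X} {β′ : Y → Y} (s t : Iso β β′) where

  goods-conj : ∀ {α g} → Goods β α g → Goods β′ (conj s t α) g
  goods-conj {α} = card-bij {S = setoid X} {setoid Y} (to t) (from t) (cong _) (cong _)
    (good-conj s t {α})
    (λ {y} p → good-resp {β = β} {conj s⁻ t⁻ (conj s t α)} {α} (conj-conj s t α) (good-conj s⁻ t⁻ {conj s t α} p))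
    (λ _ → from-to t _) (λ _ → to-from t _)
    where
    s⁻ = Iso-sym s
    t⁻ = Iso-sym t

  card-conj : ∀ {Φ Ψ k} → (∀ {α} → Φ α → Ψ (conj s t α)) →
              (∀ {α} → Ψ α → Φ (conj (Iso-sym s) (Iso-sym t) α)) →
              Card (X →-setoid X) Φ k → Card (Y →-setoid Y) Ψ k
  card-conj Φ⇒Ψ Ψ⇒Φ = card-bij (conj s t) (conj (Iso-sym s) (Iso-sym t))
    (λ e x → cong (to s) (e _)) (λ e x → cong (from s) (e _)) Φ⇒Ψ Ψ⇒Φ
    (λ {α} _ → conj-conj s t α) (λ {α} _ → conj-conj (Iso-sym s) (Iso-sym t) α)

-- The cyclic successor and its powers

skip : ∀ {m} → Fin (suc m) → Fin (suc (suc m))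
skip zero    = zero
skip (suc i) = suc (suc i)

-- Recursion on the point replaces arithmetic modulo `m`: prepending a new `zero` turns the old
-- successor into `skip` after it. This is what makes `β⁺-ins` hold by computation.
cyc : ∀ {m} → Fin m → Fin m
cyc {suc zero}    zero    = zero
cyc {suc (suc m)} zero    = suc zero
cyc {suc (suc m)} (suc i) = skip (cyc i)

toℕ-cyc : ∀ {m} (i : Fin m) →
          toℕ (cyc i) ≡ suc (toℕ i) ⊎ suc (toℕ i) ≡ m × toℕ (cyc i) ≡ 0
toℕ-cyc {suc zero}    zero    = inj₂ (refl , refl)
toℕ-cyc {suc (suc m)} zero    = inj₁ refl
toℕ-cyc {suc (suc m)} (suc i) with cyc i | toℕ-cyc i
... | zero  | inj₂ (e , _) = inj₂ (cong suc e , refl)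
... | suc j | inj₁ e       = inj₁ (cong suc e)

cyc-≢ : ∀ {m} (i : Fin (suc (suc m))) → cyc i ≢ i
cyc-≢ i e with toℕ-cyc i
... | inj₁ e′ = ℕ.1+n≢n (trans (sym e′) (cong toℕ e))
... | inj₂ (e′ , e″) with () ← trans (sym e′) (cong suc (trans (cong toℕ (sym e)) e″))

iter-+ : ∀ {n} (f : Fin n → Fin n) s t x → iter f (s + t) x ≡ iter f s (iter f t x)
iter-+ f zero    t x = refl
iter-+ f (suc s) t x = cong f (iter-+ f s t x)

iter-comm : ∀ {n} (f : Fin n → Fin n) s t x → iter f s (iter f t x) ≡ iter f t (iter f s x)
iter-comm f s t x = begin
  iter f s (iter f t x)  ≡⟨ iter-+ f s t x ⟨
  iter f (s + t) x       ≡⟨ cong (λ u → iter f u x) (ℕ.+-comm s t) ⟩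
  iter f (t + s) x       ≡⟨ iter-+ f t s x ⟩
  iter f t (iter f s x)  ∎

toℕ-iter-cyc : ∀ {m} t → t ≤ m → toℕ (iter cyc t (zero {m})) ≡ t
toℕ-iter-cyc zero    _ = refl
toℕ-iter-cyc {m} (suc t) t<m with toℕ-cyc (iter cyc t (zero {m})) | toℕ-iter-cyc {m} t (ℕ.<⇒≤ t<m)
... | inj₁ e       | e′ = trans e (cong suc e′)
... | inj₂ (e , _) | e′ = contradiction (trans (sym (ℕ.suc-injective e)) e′) (ℕ.<⇒≢ t<m ∘ sym)

iter-cyc-zero : ∀ {m} (i : Fin (suc m)) → iter cyc (toℕ i) zero ≡ i
iter-cyc-zero i = Fin.toℕ-injective (toℕ-iter-cyc (toℕ i) (ℕ.≤-pred (Fin.toℕ<n i)))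

-- Powers of `cyc` commute and every point is `iter cyc (toℕ i) zero`, so the period has to be
-- checked at `zero` only.
iter-cyc-period : ∀ {m} (i : Fin (suc m)) → iter cyc (suc m) i ≡ i
iter-cyc-period {m} i = begin
  iter cyc (suc m) i                          ≡⟨ cong (iter cyc (suc m)) (iter-cyc-zero i) ⟨
  iter cyc (suc m) (iter cyc (toℕ i) zero)    ≡⟨ iter-comm cyc (suc m) (toℕ i) zero ⟩
  iter cyc (toℕ i) (iter cyc (suc m) zero)    ≡⟨ cong (iter cyc (toℕ i)) (wrap (toℕ-cyc _) (toℕ-iter-cyc m ℕ.≤-refl)) ⟩
  iter cyc (toℕ i) zero                       ≡⟨ iter-cyc-zero i ⟩
  i                                           ∎
  where
  wrap : ∀ {j : Fin (suc m)} → toℕ (cyc j) ≡ suc (toℕ j) ⊎ suc (toℕ j) ≡ suc m × toℕ (cyc j) ≡ 0 →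
         toℕ j ≡ m → cyc j ≡ zero
  wrap (inj₂ (_ , e)) _  = Fin.toℕ-injective e
  wrap {j} (inj₁ e) e′ = contradiction (trans e (cong suc e′)) (ℕ.<⇒≢ (Fin.toℕ<n (cyc j)))

-- nothing is the fixed point of the (n-1)-cycle, with m = n - 1.
β⁺ : ∀ m → Maybe (Fin m) → Maybe (Fin m)
β⁺ m = Maybe.map cyc

Pt→ : ℕ → Setoid 0ℓ 0ℓ
Pt→ m = Maybe (Fin m) →-setoid Maybe (Fin m)

rotation : ∀ {m} → Fin (suc m) → Iso (β⁺ (suc m)) (β⁺ (suc m))
rotation {m} a = record
  { to = Maybe.map (iter cyc (toℕ a))
  ; from = Maybe.map (iter cyc (suc m ∸ toℕ a))
  ; from-to = undo (suc m ∸ toℕ a) (toℕ a) (ℕ.m∸n+n≡m a≤)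
  ; to-from = undo (toℕ a) (suc m ∸ toℕ a) (ℕ.m+[n∸m]≡n a≤)
  ; commutes = λ { nothing → refl ; (just i) → cong just (iter-comm cyc (toℕ a) 1 i) } }
  where
  a≤ : toℕ a ≤ suc m
  a≤ = ℕ.<⇒≤ (Fin.toℕ<n a)
  undo : ∀ s t → s + t ≡ suc m → (x : Maybe (Fin (suc m))) → Maybe.map (iter cyc s) (Maybe.map (iter cyc t) x) ≡ x
  undo s t eq nothing = refl
  undo s t eq (just i) = cong just (trans (sym (iter-+ cyc s t i))
    (trans (cong (λ u → iter cyc u i) eq) (iter-cyc-period {m} i)))

rotation-to : ∀ {m} (a : Fin (suc m)) → to (rotation a) (just zero) ≡ just a
rotation-to a = cong just (iter-cyc-zero a)

rotation-from : ∀ {m} (a : Fin (suc m)) → from (rotation a) (just a) ≡ just zero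
rotation-from a = trans (cong (from (rotation a)) (sym (rotation-to a))) (from-to (rotation a) _)

-- Classes of permutations

_≟ᴹ_ : ∀ {m} → DecidableEquality (Maybe (Fin m))
_≟ᴹ_ = Maybe.≡-dec Fin._≟_

module _ {X : Set} {P : Maybe X → Set} {k : ℕ} (c : Card (setoid X) (P ∘ just) k) where

  card-just : ¬ P nothing → Card (setoid (Maybe X)) P k
  card-just ¬p = record
    { at = just ∘ at c ; sound = sound c ; distinct = distinct c ∘ Maybe.just-injective
    ; index = λ { {just x} p → index c p ; {nothing} p → contradiction p ¬p }
    ; at-index = λ { {just x} p → cong just (at-index c p) ; {nothing} p → contradiction p ¬p } }

  card-nothing : P nothing → Card (setoid (Maybe X)) P (suc k)
  card-nothing p₀ = record
    { at = λ { zero → nothing ; (suc i) → just (at c i) }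
    ; sound = λ { zero → p₀ ; (suc i) → sound c i }
    ; distinct = λ { {zero} {zero} _ → refl
                   ; {suc i} {suc j} e → cong suc (distinct c (Maybe.just-injective e)) }
    ; index = λ { {nothing} _ → zero ; {just x} p → suc (index c p) }
    ; at-index = λ { {nothing} _ → refl ; {just x} p → cong just (at-index c p) } }

card-Pt : ∀ m → Card (setoid (Maybe (Fin m))) (λ _ → ⊤) (suc m)
card-Pt m = card-nothing (card-Fin m) tt

Pt-all? : ∀ {m} {P : Maybe (Fin m) → Set} → Decidable P → Dec (∀ x → P x)
Pt-all? P? = Dec.map′ (λ { (p , q) → λ { nothing → p ; (just i) → q i } }) (λ f → f nothing , f ∘ just)
  (P? nothing ×-dec Fin.all? (P? ∘ just))

inj? : ∀ {m} (α : Maybe (Fin m) → Maybe (Fin m)) → Dec (Inj α)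
inj? α = Dec.map′ (λ f {x} {y} → f x y) (λ f x y → f {x} {y})
  (Pt-all? λ x → Pt-all? λ y → (α x ≟ᴹ α y) →-dec (x ≟ᴹ y))

module _ {m : ℕ} (β α : Maybe (Fin m) → Maybe (Fin m)) where

  good? : Decidable (Good β α)
  good? x = α (β x) ≟ᴹ β (α x)

  goods-exist : ∃ (Goods β α)
  goods-exist with card-filter (card-Pt m) (λ { refl p → p }) (λ {x} _ → good? x)
  ... | k , c = k , card-⇔ (setoid _) proj₂ (tt ,_) c

  goods? : ∀ g → Dec (Goods β α g)
  goods? g = Dec.map′ (λ { refl → proj₂ goods-exist }) (λ c → card-unique (setoid _) (proj₂ goods-exist) c)
    (proj₁ goods-exist ℕ.≟ g)

-- Ends ε (α nothing) says whether α fixes (ε = true) or moves (ε = false) the fixed point of β.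
data Ends {m} : Bool → Maybe (Fin m) → Set where
  fixes : Ends true nothing
  moves : ∀ {u} → Ends false (just u)

ends-true : ∀ {m} {x : Maybe (Fin m)} → Ends true x → x ≡ nothing
ends-true fixes = refl

ends? : ∀ {m} ε (x : Maybe (Fin m)) → Dec (Ends ε x)
ends? true  nothing  = yes fixes
ends? true  (just u) = no λ ()
ends? false nothing  = no λ ()
ends? false (just u) = yes moves

ends-map : ∀ {m n ε x} (f : Fin m → Fin n) → Ends ε x → Ends ε (Maybe.map f x)
ends-map f fixes = fixes
ends-map f moves = moves

record Class (ε : Bool) (m g : ℕ) (α : Maybe (Fin m) → Maybe (Fin m)) : Set where
  constructor mkClass
  field
    inj   : Inj α
    goods : Goods (β⁺ m) α g
    ends  : Ends ε (α nothing)
open Class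

good-nothing : ∀ {m g α} → Class true m g α → Good (β⁺ m) α nothing
good-nothing {m} cl = trans α∞ (cong (β⁺ m) (sym α∞))
  where α∞ = ends-true (ends cl)

class-resp : ∀ {ε m g} → Class ε m g Respects _≗_
class-resp {ε} {m} {_} {α} {α′} e (mkClass i g d) =
  mkClass (inj-resp e i) (goods-resp {β = β⁺ m} {α} {α′} e g) (subst (Ends ε) (e nothing) d)

class? : ∀ {ε m g} α → Dec (Class ε m g α)
class? {ε} {m} {g} α = Dec.map′ {A = Inj α × Goods (β⁺ m) α g × Ends ε (α nothing)}
  (λ (i , g , e) → mkClass i g e) (λ c → inj c , goods c , ends c)
  (inj? α ×-dec goods? (β⁺ m) α g ×-dec ends? ε (α nothing))

class-rotate : ∀ {ε m g α} (b a : Fin (suc m)) → Class ε (suc m) g α →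
               Class ε (suc m) g (conj (rotation b) (rotation a) α)
class-rotate {α = α} b a (mkClass i g e) = mkClass (conj-injective (rotation b) (rotation a) {α} i)
  (goods-conj (rotation b) (rotation a) {α} g) (ends-map _ e)

class-unrotate : ∀ {ε m g α} (b a : Fin (suc m)) → Class ε (suc m) g α →
                 Class ε (suc m) g (conj (Iso-sym (rotation b)) (Iso-sym (rotation a)) α)
class-unrotate {α = α} b a (mkClass i g e) = mkClass (conj-injective (Iso-sym (rotation b)) (Iso-sym (rotation a)) {α} i)
  (goods-conj (Iso-sym (rotation b)) (Iso-sym (rotation a)) {α} g) (ends-map _ e)

-- The index `m` is one less than the length of the cycle: this is the set counted by Z⁰(m + 1, g).
Rooted : Bool → (m g : ℕ) → (Maybe (Fin (suc m)) → Maybe (Fin (suc m))) → Set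
Rooted ε m g α = Class ε (suc m) g α × α (just zero) ≡ just zero

GoodRooted : Bool → (m g : ℕ) → (Maybe (Fin (suc m)) → Maybe (Fin (suc m))) → Set
GoodRooted ε m g α = Class ε (suc m) g α × α (just zero) ≡ just zero × Good (β⁺ (suc m)) α (just zero)

-- Contraction of the point zero

module _ {m : ℕ} where
  private
    Pt = Maybe (Fin (suc m))
    Pt⁺ = Maybe (Fin (suc (suc m)))

  ins : Pt → Pt⁺
  ins = Maybe.map suc

  skipᴹ : Pt → Pt⁺
  skipᴹ = Maybe.map skip

  -- The value at `just zero` is a default: `fixes-root` shows that `contract` never reaches it when
  -- `α` is injective and fixes the root.
  collapse : Pt⁺ → Pt
  collapse (just zero)    = just zero
  collapse (just (suc i)) = just i
  collapse nothing        = nothing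

  expand : (Pt → Pt) → Pt⁺ → Pt⁺
  expand α (just zero)    = just zero
  expand α (just (suc i)) = ins (α (just i))
  expand α nothing        = ins (α nothing)

  contract : (Pt⁺ → Pt⁺) → Pt → Pt
  contract α = collapse ∘ α ∘ ins

  skip-injective : ∀ {i j} → skip {m} i ≡ skip j → i ≡ j
  skip-injective {zero}  {zero}  e = refl
  skip-injective {suc i} {suc j} e = Fin.suc-injective e

  ins-injective : ∀ {x y} → ins x ≡ ins y → x ≡ y
  ins-injective = Maybe.map-injective Fin.suc-injective

  ins-≢0 : ∀ x → ins x ≢ just zero
  ins-≢0 (just i) ()

  skipᴹ-≢0 : ∀ {x} → x ≢ just zero → skipᴹ x ≡ ins x
  skipᴹ-≢0 {just zero}    x≢ = contradiction refl x≢
  skipᴹ-≢0 {just (suc i)} x≢ = refl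
  skipᴹ-≢0 {nothing}      x≢ = refl

  collapse-ins : ∀ x → collapse (ins x) ≡ x
  collapse-ins (just i) = refl
  collapse-ins nothing  = refl

  ins-collapse : ∀ {x} → x ≢ just zero → ins (collapse x) ≡ x
  ins-collapse {just zero}    x≢ = contradiction refl x≢
  ins-collapse {just (suc i)} x≢ = refl
  ins-collapse {nothing}      x≢ = refl

  data View : Pt⁺ → Set where
    root : View (just zero)
    rest : ∀ x → View (ins x)

  view : ∀ x → View x
  view (just zero)    = root
  view (just (suc i)) = rest (just i)
  view nothing        = rest nothing

  expand-ins : ∀ α x → expand α (ins x) ≡ ins (α x)
  expand-ins α (just i) = refl
  expand-ins α nothing  = refl

  β⁺-ins : ∀ x → β⁺ (suc (suc m)) (ins x) ≡ skipᴹ (β⁺ (suc m) x)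
  β⁺-ins (just i) = refl
  β⁺-ins nothing  = refl

  contract-expand : ∀ α → contract (expand α) ≗ α
  contract-expand α x = trans (cong collapse (expand-ins α x)) (collapse-ins (α x))

  expand-cong : ∀ {α α′} → α ≗ α′ → expand α ≗ expand α′
  expand-cong e (just zero)    = refl
  expand-cong e (just (suc i)) = cong ins (e (just i))
  expand-cong e nothing        = cong ins (e nothing)

  expand-injective : ∀ {α} → Inj α → Inj (expand α)
  expand-injective {α} i {x} {y} e with view x | view y
  ... | root   | root   = refl
  ... | root   | rest y = contradiction (trans (sym (expand-ins α y)) (sym e)) (ins-≢0 (α y))
  ... | rest x | root   = contradiction (trans (sym (expand-ins α x)) e) (ins-≢0 (α x))
  ... | rest x | rest y = cong ins (i (ins-injective (trans (sym (expand-ins α x)) (trans e (expand-ins α y)))))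

  module _ {α : Pt⁺ → Pt⁺} (i : Inj α) (α0 : α (just zero) ≡ just zero) where

    fixes-root : ∀ x → α (ins x) ≢ just zero
    fixes-root x e = ins-≢0 x (i (trans e (sym α0)))

    expand-contract : expand (contract α) ≗ α
    expand-contract x with view x
    ... | root   = sym α0
    ... | rest x = trans (expand-ins (contract α) x) (ins-collapse (fixes-root x))

    contract-injective : Inj (contract α)
    contract-injective {x} {y} e = ins-injective (i (trans (sym (ins-collapse (fixes-root x)))
      (trans (cong ins e) (ins-collapse (fixes-root y)))))

  module _ {α : Pt → Pt} (i : Inj α) (α0 : α (just zero) ≡ just zero) where

    -- expand α intertwines both ins and skipᴹ, and β⁺ ∘ ins ≗ skipᴹ ∘ β⁺; as skipᴹ is injective,
    -- goodness passes between α and expand α.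
    expand-skipᴹ : ∀ x → expand α (skipᴹ x) ≡ skipᴹ (α x)
    expand-skipᴹ x with x ≟ᴹ just zero
    ... | yes refl = cong skipᴹ (sym α0)
    ... | no x≢ = begin
      expand α (skipᴹ x)  ≡⟨ cong (expand α) (skipᴹ-≢0 x≢) ⟩
      expand α (ins x)    ≡⟨ expand-ins α x ⟩
      ins (α x)           ≡⟨ skipᴹ-≢0 (λ e → x≢ (i (trans e (sym α0)))) ⟨
      skipᴹ (α x)         ∎

    private
      lhs : ∀ x → expand α (β⁺ (suc (suc m)) (ins x)) ≡ skipᴹ (α (β⁺ (suc m) x))
      lhs x = trans (cong (expand α) (β⁺-ins x)) (expand-skipᴹ (β⁺ (suc m) x))
      rhs : ∀ x → β⁺ (suc (suc m)) (expand α (ins x)) ≡ skipᴹ (β⁺ (suc m) (α x))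
      rhs x = trans (cong (β⁺ (suc (suc m))) (expand-ins α x)) (β⁺-ins (α x))

    good-expand : ∀ {x} → Good (β⁺ (suc m)) α x → Good (β⁺ (suc (suc m))) (expand α) (ins x)
    good-expand {x} p = trans (lhs x) (trans (cong skipᴹ p) (sym (rhs x)))

    good-expand⁻ : ∀ {x} → Good (β⁺ (suc (suc m))) (expand α) (ins x) → Good (β⁺ (suc m)) α x
    good-expand⁻ {x} p = Maybe.map-injective skip-injective (trans (sym (lhs x)) (trans p (rhs x)))

    -- The successor of the new root is the old root, and `expand α` fixes both.
    good-expand-root : Good (β⁺ (suc (suc m))) (expand α) (just zero)
    good-expand-root = cong ins α0

    goods-expand : ∀ {g} → Goods (β⁺ (suc m)) α g → Goods (β⁺ (suc (suc m))) (expand α) (suc g)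
    goods-expand c = record
      { at = at′
      ; sound = λ { zero → good-expand-root ; (suc j) → good-expand (sound c j) }
      ; distinct = λ { {zero} {zero} _ → refl
                     ; {zero} {suc j} e → contradiction (sym e) (ins-≢0 (at c j))
                     ; {suc j} {zero} e → contradiction e (ins-≢0 (at c j))
                     ; {suc j} {suc k} e → cong suc (distinct c (ins-injective e)) }
      ; index = λ {x} → index′ {x} (view x)
      ; at-index = λ {x} → at-index′ {x} (view x) }
      where
      at′ : Fin (suc _) → Pt⁺
      at′ zero    = just zero
      at′ (suc j) = ins (at c j)
      index′ : ∀ {x} → View x → Good (β⁺ (suc (suc m))) (expand α) x → Fin (suc _)
      index′ root     _ = zero
      index′ (rest x) p = suc (index c (good-expand⁻ {x} p))
      at-index′ : ∀ {x} (v : View x) (p : Good (β⁺ (suc (suc m))) (expand α) x) → at′ (index′ v p) ≡ x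
      at-index′ root     _ = refl
      at-index′ (rest x) p = cong ins (at-index c (good-expand⁻ {x} p))

  -- The contraction has some number of good points; expanding again adds the root to them, and
  -- uniqueness of cardinality compares the result with `suc g`.
  contract-goods : ∀ {α g} → Inj α → α (just zero) ≡ just zero → contract α (just zero) ≡ just zero →
                   Goods (β⁺ (suc (suc m))) α (suc g) → Goods (β⁺ (suc m)) (contract α) g
  contract-goods {α} i α0 α1 c =
    let g′ , c′ = goods-exist (β⁺ (suc m)) (contract α)
        e = card-unique (setoid Pt⁺)
              (goods-resp {β = β⁺ (suc (suc m))} (expand-contract i α0) (goods-expand (contract-injective i α0) α1 c′)) c
    in subst (Goods (β⁺ (suc m)) (contract α)) (ℕ.suc-injective e) c′

  ends-collapse : ∀ {ε x} → Ends ε x → Ends ε (collapse x)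
  ends-collapse fixes             = fixes
  ends-collapse (moves {zero})    = moves
  ends-collapse (moves {suc u})   = moves

  -- When `α` fixes the root, goodness of the root says that `α` also fixes its successor. That
  -- successor is the root of the contraction, so the contraction is again rooted.
  card-contract : ∀ {ε g t} → Card (Pt→ (suc m)) (Rooted ε m g) t →
                  Card (Pt→ (suc (suc m))) (GoodRooted ε (suc m) (suc g)) t
  card-contract {ε} {g} = card-bij expand contract expand-cong (λ e x → cong collapse (e (ins x)))
    (λ {α} (mkClass i c d , α0) →
       mkClass (expand-injective i) (goods-expand i α0 c) (ends-map suc d) , refl , good-expand-root i α0)
    (λ {α} (mkClass i c d , α0 , p) → let α1 = α1′ {α} α0 p in
       mkClass (contract-injective i α0) (contract-goods i α0 α1 c) (ends-collapse d) , α1)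
    (λ {α} _ → contract-expand α)
    (λ (mkClass i _ _ , α0 , _) → expand-contract i α0)
    where
    α1′ : ∀ {α} → α (just zero) ≡ just zero → Good (β⁺ (suc (suc m))) α (just zero) →
          contract α (just zero) ≡ just zero
    α1′ α0 p = cong collapse (trans p (cong (β⁺ (suc (suc m))) α0))

-- Double counting

card-Fin² : ∀ m → Card (setoid (Fin m × Fin m)) (λ _ → ⊤) (m * m)
card-Fin² m = record
  { at = remQuot m ; sound = λ _ → tt
  ; distinct = λ {i} {j} e → trans (sym (Fin.combine-remQuot {m} m i))
                 (trans (cong (uncurry combine) e) (Fin.combine-remQuot {m} m j))
  ; index = λ { {i , j} _ → combine i j }
  ; at-index = λ { {i , j} _ → Fin.remQuot-combine i j } }

module _ {ε : Bool} {m g : ℕ} {z : ℕ}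
         (W : (Maybe (Fin (suc m)) → Maybe (Fin (suc m))) → Maybe (Fin (suc m)) → Set)
         (W-resp : ∀ {α α′ x} → α ≗ α′ → W α x → W α′ x)
         (W-conj : ∀ {α x} (s t : Iso (β⁺ (suc m)) (β⁺ (suc m))) → W α x → W (conj s t α) (to t x))
         (class : Card (Pt→ (suc m)) (Class ε (suc m) g) z) where

  private
    R : (Maybe (Fin (suc m)) → Maybe (Fin (suc m))) → Fin (suc m) × Fin (suc m) → Set
    R α (a , b) = Class ε (suc m) g α × α (just a) ≡ just b × W α (just a)

  -- Both sides count the pairs (α , a) with a marked by W; rotating the source and the target
  -- reduces each pair (a , α a) to (zero , zero).
  count-marked : ∀ {w t} →
    (∀ {α} → Class ε (suc m) g α →
       Card (setoid (Fin (suc m))) (λ a → α (just a) ≢ nothing × W α (just a)) w) →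
    Card (Pt→ (suc m)) (λ α → Class ε (suc m) g α × α (just zero) ≡ just zero × W α (just zero)) t →
    z * w ≡ suc m * suc m * t
  count-marked marks rooted = double-count {S = Pt→ (suc m)} {T = setoid (Fin (suc m) × Fin (suc m))} {R = R}
    (λ {α} {α′} e (c , q , w) → class-resp e c , trans (sym (e _)) q , W-resp e w)
    (λ { refl r → r })
    (λ (c , _) → c , tt)
    class
    (λ {α} c → card-bij {S = setoid (Fin (suc m))} {T = setoid (Fin (suc m) × Fin (suc m))}
       -- The default `zero` is never taken, since marked points satisfy `α (just a) ≢ nothing`.
       (λ a → a , fromMaybe zero (α (just a))) proj₁ (λ { refl → refl }) (cong proj₁)
       (λ {a} (q , w) → c , just-fromMaybe q , w)
       (λ { (_ , q , w) → (λ e → just≢nothing (trans (sym q) e)) , w })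
       (λ _ → refl)
       (λ { {a , b} (_ , q , _) → cong (λ x → a , fromMaybe zero x) q })
       (marks c))
    (card-Fin² (suc m))
    λ { {a , b} _ → card-conj (rotation b) (rotation a)
       (λ {α} (c , q , w) → class-rotate b a c
          , trans (cong (to (rotation b) ∘ α) (rotation-from a)) (trans (cong (to (rotation b)) q) (rotation-to b))
          , subst (W (conj (rotation b) (rotation a) α)) (rotation-to a) (W-conj (rotation b) (rotation a) w))
       (λ {α} (c , q , w) → class-unrotate b a c
          , trans (cong (from (rotation b) ∘ α) (rotation-to a)) (trans (cong (from (rotation b)) q) (rotation-from b))
          , subst (W (conj (Iso-sym (rotation b)) (Iso-sym (rotation a)) α)) (rotation-from a)
              (W-conj (Iso-sym (rotation b)) (Iso-sym (rotation a)) w))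
       rooted }
    where
    just≢nothing : ∀ {b : Fin (suc m)} → just b ≢ nothing
    just≢nothing ()
    just-fromMaybe : ∀ {x : Maybe (Fin (suc m))} → x ≢ nothing → x ≡ just (fromMaybe zero x)
    just-fromMaybe {just b}  _ = refl
    just-fromMaybe {nothing} q = contradiction refl q

-- Number of points `a` of a cycle of length `suc m` with `α (just a) ≢ nothing`: one is lost when
-- the preimage of `nothing` lies on the cycle.
moved : Bool → ℕ → ℕ
moved true  m = suc m
moved false m = m

nothing? : ∀ {m} (x : Maybe (Fin m)) → Dec (x ≡ nothing)
nothing? x = x ≟ᴹ nothing

true-moves : ∀ {m g α} → Class true m g α → ∀ a → α (just a) ≢ nothing
true-moves {α = α} c a e with α nothing in eq | ends c
... | nothing | fixes with () ← inj c (trans e (sym eq))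

false-hits : ∀ {m g α} → Class false m g α → ∃ λ v → α (just v) ≡ nothing
false-hits {m} {α = α} c with injective⇒surjective (card-Pt m) (inj c) nothing
... | just v , e = v , e
... | nothing , e with α nothing | ends c
...   | just _ | moves with () ← e

card-moved : ∀ {ε m g α} → Class ε (suc m) g α →
             Card (setoid (Fin (suc m))) (λ a → α (just a) ≢ nothing) (moved ε m)
card-moved {true} {m} c = card-⇔ (setoid _) (λ {a} _ → true-moves c a) (λ _ → tt) (card-Fin (suc m))
card-moved {false} {m} {α = α} c =
  let k , l , ck , cl , e = card-split (card-Fin (suc m)) (λ { refl p → p }) (λ {a} _ → nothing? (α (just a)))
      v , q = false-hits c
      k≡1 = card-unique (setoid _) ck (card-singleton (setoid _) {x = v} (tt , q)
              (λ (_ , q′) → Maybe.just-injective (inj c (trans q (sym q′)))))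
  in subst (Card _ _) (ℕ.suc-injective (sym (trans e (cong (_+ l) k≡1)))) (card-⇔ (setoid _) proj₂ (tt ,_) cl)

-- The contribution of `nothing` to the number of good points.
fixing : Bool → ℕ
fixing true  = 1
fixing false = 0

-- If `α` sent a good `just a` to `nothing`, it would send the successor of `a` there too;
-- injectivity would make `a` a fixed point of `cyc`, impossible on a cycle of length at least two.
good⇒moved : ∀ {ε m g α a} → Class ε (suc (suc m)) g α → Good (β⁺ (suc (suc m))) α (just a) →
             α (just a) ≢ nothing
good⇒moved {α = α} {a} c p e = cyc-≢ a (Maybe.just-injective (inj c
  (trans p (trans (cong (β⁺ _) e) (sym e)))))

-- Only `nothing` has to be separated off. It is good when fixed; when `α nothing` is `just u`,
-- goodness would force `cyc u ≡ u`.
card-good : ∀ {ε m g α} → Class ε (suc (suc m)) (fixing ε + g) α →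
            Card (setoid (Fin (suc (suc m)))) (λ a → Good (β⁺ (suc (suc m))) α (just a)) g
card-good {ε} {m} {g} {α} c = subst (Card _ _) (sym (eq ε (ends c) (goods c))) c′
  where
  k = proj₁ (card-filter (card-Fin (suc (suc m))) (λ { refl p → p }) (λ {a} _ → good? (β⁺ _) α (just a)))
  c′ : Card (setoid _) (λ a → Good (β⁺ (suc (suc m))) α (just a)) k
  c′ = card-⇔ (setoid _) proj₂ (tt ,_)
    (proj₂ (card-filter (card-Fin (suc (suc m))) (λ { refl p → p }) (λ {a} _ → good? (β⁺ _) α (just a))))
  eq : ∀ ε → Ends ε (α nothing) → Goods (β⁺ _) α (fixing ε + g) → g ≡ k
  eq true e d = ℕ.suc-injective (card-unique (setoid _) d (card-nothing c′ fixed))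
    where
    α∞ = ends-true e
    fixed : Good (β⁺ _) α nothing
    fixed = trans α∞ (cong (β⁺ _) (sym α∞))
  eq false e d = card-unique (setoid _) d (card-just c′ (moved′ e))
    where
    moved′ : ∀ {x} → Ends false x → x ≢ β⁺ (suc (suc m)) x
    moved′ (moves {u}) q = cyc-≢ u (sym (Maybe.just-injective q))

-- The first double count, with every point marked.
class-rooted : ∀ {ε m g z t} → Card (Pt→ (suc m)) (Class ε (suc m) g) z →
               Card (Pt→ (suc m)) (Rooted ε m g) t → z * moved ε m ≡ suc m * suc m * t
class-rooted {m = m} c r = count-marked (λ _ _ → ⊤) (λ _ _ → tt) (λ _ _ _ → tt) c
  (λ d → card-⇔ (setoid _) (_, tt) proj₁ (card-moved d))
  (card-⇔ (Pt→ (suc m)) (λ (d , q) → d , q , tt) (λ (d , q , _) → d , q) r)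

-- The second double count, with the `suc g` good points of the cycle marked. The rooted pairs are
-- those whose root is good, and contraction counts them on a shorter cycle.
class-good : ∀ {ε m g z t} → Card (Pt→ (suc (suc m))) (Class ε (suc (suc m)) (fixing ε + suc g)) z →
             Card (Pt→ (suc m)) (Rooted ε m (fixing ε + g)) t →
             z * suc g ≡ suc (suc m) * suc (suc m) * t
class-good {ε} {m} {g} {t = t} c r = count-marked (Good (β⁺ _))
  (λ {α} {α′} e → good-resp {β = β⁺ _} {α} {α′} e) (λ {α} s s′ → good-conj s s′ {α}) c
  (λ d → card-⇔ (setoid _) (λ p → good⇒moved d p , p) proj₂ (card-good {g = suc g} d))
  (subst (λ h → Card (Pt→ (suc (suc m))) (GoodRooted ε (suc m) h) t) (sym (ℕ.+-suc (fixing ε) g)) (card-contract r))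

-- Enumeration of functions

concatMap-map : ∀ {A B C : Set} (f : A → B → C) xs ys →
                concatMap (λ x → map (f x) ys) xs ≡ cartesianProductWith f xs ys
concatMap-map f []       ys = refl
concatMap-map f (x ∷ xs) ys = cong (map (f x) ys ++_) (concatMap-map f xs ys)

Fin→ : ℕ → ℕ → Setoid 0ℓ 0ℓ
Fin→ n m = Fin n →-setoid Fin m

allFuns-complete : ∀ n m (f : Fin n → Fin m) → Any (f ≗_) (allFuns n m)
allFuns-complete zero    m f = here λ ()
allFuns-complete (suc n) m f
  rewrite concatMap-map (λ f b → cons b f) (allFuns n m) (allFin m) =
  Membership.∈-resp-≈ (Fin→ (suc n) m) {allFuns′} {cons (f zero) (f ∘ suc)} {f} (λ { zero → refl ; (suc i) → refl })
    (Membership.∈-cartesianProductWith⁺ (Fin→ n m) (setoid (Fin m)) (Fin→ (suc n) m)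
      (λ { e refl zero → refl ; e refl (suc i) → e i })
      (allFuns-complete n m (f ∘ suc)) (Membership≡.∈-allFin (f zero)))
  where allFuns′ = cartesianProductWith (λ f b → cons b f) (allFuns n m) (allFin m)

allFuns-unique : ∀ n m → Unique (Fin→ n m) (allFuns n m)
allFuns-unique zero    m = [] ∷ []
allFuns-unique (suc n) m
  rewrite concatMap-map (λ f b → cons b f) (allFuns n m) (allFin m) =
  Unique.cartesianProductWith⁺ (Fin→ n m) (setoid (Fin m)) (Fin→ (suc n) m) (λ f b → cons b f)
    (λ e → e ∘ suc , e zero) (allFuns-unique n m) (Unique≡.allFin⁺ m)

card-countFuns : ∀ {n P} (P? : (f : Fin n → Fin n) → Dec (P f)) → P Respects _≗_ →
                 Card (Fin→ n n) P (countFuns n P?)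
card-countFuns {n} P? resp = card-filter-list (Fin→ n n) P? resp (allFuns-unique n n) (allFuns-complete n n)

perm-resp : ∀ {n} → IsPerm {n} Respects _≗_
perm-resp e p i j q = p i j (trans (e i) (trans q (sym (e j))))

card-Snum : ∀ l → Card (Fin→ l l) (λ π → IsPerm π × NoSuccession π) (Snum l)
card-Snum l = card-countFuns _ λ e (p , s) → perm-resp e p ,
  λ i i′ q q′ → s i i′ q (trans (cong toℕ (e i′)) (trans q′ (cong (suc ∘ toℕ) (sym (e i)))))

iter-cong : ∀ {n} {f g : Fin n → Fin n} → f ≗ g → ∀ t → iter f t ≗ iter g t
iter-cong         e zero    x = refl
iter-cong {g = g} e (suc t) x = trans (e _) (cong g (iter-cong e t x))

card-Cnum : ∀ k → Card (Fin→ k k) (λ σ → (IsPerm σ × IsCyclic σ) × NoCyclicSucc σ) (Cnum k)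
card-Cnum k = card-countFuns _ λ e ((p , c) , s) →
  (perm-resp e p , λ x y → let t , q = c x y in t , trans (sym (iter-cong e (toℕ t) x)) q) ,
  λ i → (λ q → proj₁ (s i) (trans (cong toℕ (e i)) q)) , (λ q q′ → proj₂ (s i) q (trans (cong toℕ (e i)) q′))

cyc-suc : ∀ {m} {i j : Fin m} → toℕ j ≡ suc (toℕ i) → cyc i ≡ j
cyc-suc {i = i} {j} e with toℕ-cyc i
... | inj₁ e′       = Fin.toℕ-injective (trans e′ (sym e))
... | inj₂ (e′ , _) = contradiction (trans e e′) (ℕ.<⇒≢ (Fin.toℕ<n j))

noCyclicSucc⇒ : ∀ {m σ} → NoCyclicSucc {m} σ → ∀ i → σ i ≢ cyc i
noCyclicSucc⇒ s i e with toℕ-cyc i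
... | inj₁ e′        = proj₁ (s i) (trans (cong toℕ e) e′)
... | inj₂ (e′ , e″) = proj₂ (s i) e′ (trans (cong toℕ e) e″)

noCyclicSucc⇐ : ∀ {m σ} → (∀ i → σ i ≢ cyc i) → NoCyclicSucc {m} σ
noCyclicSucc⇐ {σ = σ} s i = (λ e → s i (sym (cyc-suc e))) , wrap
  where
  wrap : suc (toℕ i) ≡ _ → toℕ (σ i) ≢ 0
  wrap e e′ with toℕ-cyc i
  ... | inj₁ e″       = contradiction (trans e″ e) (ℕ.<⇒≢ (Fin.toℕ<n (cyc i)))
  ... | inj₂ (_ , e″) = s i (Fin.toℕ-injective (trans e′ (sym e″)))

iter-cyc-transitive : ∀ {m} (i j : Fin (suc m)) → ∃ λ (t : Fin (suc m)) → iter cyc (toℕ t) i ≡ j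
iter-cyc-transitive {m} i j = t , (begin
  iter cyc (toℕ t) i                        ≡⟨ cong (iter cyc (toℕ t)) (iter-cyc-zero i) ⟨
  iter cyc (toℕ t) (iter cyc (toℕ i) zero)  ≡⟨ iter-comm cyc (toℕ t) (toℕ i) zero ⟩
  iter cyc (toℕ i) (iter cyc (toℕ t) zero)  ≡⟨ cong (iter cyc (toℕ i)) (iter-cyc-zero t) ⟩
  iter cyc (toℕ i) t                        ≡⟨ Maybe.just-injective (to-from (rotation i) (just j)) ⟩
  j                                         ∎)
  -- The difference of `j` and `i` modulo `suc m`: rotating `j` back by `i` gives a point that is
  -- its own exponent, by `iter-cyc-zero`.
  where t = iter cyc (suc m ∸ toℕ i) j

-- Base of the recurrence: cyclic permutations

-- The cycle notation of `σ` started at `zero`, as a map from positions to points. For cyclic `σ` it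
-- conjugates `cyc` into `σ`.
word : ∀ {k} → (Fin (suc k) → Fin (suc k)) → Fin (suc k) → Fin (suc k)
word σ i = iter σ (toℕ i) zero

module _ {k : ℕ} {σ : Fin (suc k) → Fin (suc k)} (perm : IsPerm σ) (cyclic : IsCyclic σ) where

  word-surjective : ∀ y → ∃ λ i → word σ i ≡ y
  word-surjective = cyclic zero

  word-injective : Inj (word σ)
  word-injective = surjective⇒injective (card-Fin (suc k)) word-surjective

  -- Only the last position needs an argument. There `σ (word σ i)` is the entry at some position;
  -- if that were `suc j`, cancelling `σ` would put `i` at position `j`, which is not the last.
  word-cyc : ∀ i → word σ (cyc i) ≡ σ (word σ i)
  word-cyc i with toℕ-cyc i
  ... | inj₁ e = cong (λ t → iter σ t zero) e
  ... | inj₂ (e , e′) with word-surjective (σ (word σ i))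
  ...   | zero  , q = trans (cong (λ t → iter σ t zero) e′) q
  ...   | suc j , q = contradiction
    (trans (cong toℕ (word-injective (trans (perm _ _ (sym q))
                       (cong (λ t → iter σ t zero) (sym (Fin.toℕ-inject₁ j))))))
           (Fin.toℕ-inject₁ j))
    (λ r → ℕ.<⇒≢ (Fin.toℕ<n j) (ℕ.suc-injective (trans (cong suc (sym r)) e)))

-- α corresponds to σ = α ∘ cyc ∘ α⁻¹, and σ to its orbit of zero.
card-cyclic-base : ∀ k → Card (Pt→ (suc k)) (Rooted true k 1) (Cnum (suc k))
card-cyclic-base k = card-image {S = Fin→ (suc k) (suc k)} {T = Pt→ (suc k)}
  (Maybe.map ∘ word)
  (λ e → λ { nothing → refl ; (just i) → cong just (iter-cong e (toℕ i) zero) })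
  (λ ((p , c) , s) → mkClass (Maybe.map-injective (word-injective p c))
     -- By `word-cyc`, a good `just i` would be a cyclic succession of `σ` at `word σ i`; this
     -- leaves `nothing` as the only good point.
     (card-nothing (card-∅ (setoid _) (λ {i} g → noCyclicSucc⇒ s (word _ i)
       (trans (sym (word-cyc p c i)) (Maybe.just-injective g)))) refl)
     fixes , refl)
  (λ {σ} {σ′} ((p , c) , _) ((p′ , c′) , _) e x → let
       i , q = word-surjective p c x
       w≡ = λ i → Maybe.just-injective (e (just i))
     in begin
       σ x               ≡⟨ cong σ q ⟨
       σ (word σ i)      ≡⟨ word-cyc p c i ⟨
       word σ (cyc i)    ≡⟨ w≡ (cyc i) ⟩
       word σ′ (cyc i)   ≡⟨ word-cyc p′ c′ i ⟩
       σ′ (word σ′ i)    ≡⟨ cong σ′ (w≡ i) ⟨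
       σ′ (word σ i)     ≡⟨ cong σ′ q ⟩
       σ′ x              ∎)
  surj
  (card-Cnum (suc k))
  where
  surj : ∀ {α} → Rooted true k 1 α →
         ∃ λ σ → ((IsPerm σ × IsCyclic σ) × NoCyclicSucc σ) × Maybe.map (word σ) ≗ α
  surj {α} (cl , α0) = σ , ((perm , cyclic) , noCyclicSucc⇐ nosucc) , λ
    { nothing → sym (ends-true (ends cl))
    ; (just i) → trans (cong (just ∘ iter σ (toℕ i)) (sym a0))
        (trans (cong just (trans (iter-a (toℕ i) zero) (cong a (iter-cyc-zero i)))) (sym (α-just i))) }
    where
    a : Fin (suc k) → Fin (suc k)
    a i = fromMaybe zero (α (just i))
    α-just : ∀ i → α (just i) ≡ just (a i)
    α-just i with α (just i) | true-moves cl i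
    ... | just _  | _ = refl
    ... | nothing | q = contradiction refl q
    a0 : a zero ≡ zero
    a0 = cong (fromMaybe zero) α0
    a-injective : Inj a
    a-injective {i} {j} e = Maybe.just-injective (inj cl (trans (α-just i) (trans (cong just e) (sym (α-just j)))))
    a⁻ : ∀ x → ∃ λ i → a i ≡ x
    a⁻ = Fin-injective⇒surjective a-injective
    σ : Fin (suc k) → Fin (suc k)
    σ x = a (cyc (proj₁ (a⁻ x)))
    σ-a : ∀ i → σ (a i) ≡ a (cyc i)
    σ-a i = cong (a ∘ cyc) (a-injective (proj₂ (a⁻ (a i))))
    iter-a : ∀ t i → iter σ t (a i) ≡ a (iter cyc t i)
    iter-a zero    i = refl
    iter-a (suc t) i = trans (cong σ (iter-a t i)) (σ-a _)
    cyc-injective : Inj (cyc {suc k})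
    cyc-injective = surjective⇒injective (card-Fin (suc k)) λ y → iter cyc k y , iter-cyc-period y
    perm : IsPerm σ
    perm x y e = trans (sym (proj₂ (a⁻ x))) (trans (cong a (cyc-injective (a-injective e))) (proj₂ (a⁻ y)))
    cyclic : IsCyclic σ
    cyclic x y = let i , p = a⁻ x ; j , q = a⁻ y ; t , r = iter-cyc-transitive i j in
      t , trans (cong (iter σ (toℕ t)) (sym p)) (trans (iter-a (toℕ t) i) (trans (cong a r) q))
    nosucc : ∀ x → σ x ≢ cyc x
    -- The single good point is already `nothing`; a succession at `x` would make the preimage of
    -- `x` a second one.
    nosucc x e = just≢nothing (card-1 (setoid _) (goods cl) good-i (good-nothing cl))
      where
      i = proj₁ (a⁻ x)
      a-i = proj₂ (a⁻ x)
      just≢nothing : just i ≢ nothing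
      just≢nothing ()
      good-i : Good (β⁺ (suc k)) α (just i)
      good-i = trans (α-just (cyc i)) (trans (cong just (trans e (cong cyc (sym a-i)))) (cong (β⁺ (suc k)) (sym (α-just i))))

-- Base of the recurrence: permutations without succession

-- Exchanging `nothing` and `zero` cuts the cycle open at `zero` in both source and target, leaving
-- a line of `suc l` points on which `π` acts.
place : ∀ {l} → (Fin (suc l) → Fin (suc l)) → Maybe (Fin (2 + l)) → Maybe (Fin (2 + l))
place π nothing        = just zero
place π (just zero)    = nothing
place π (just (suc i)) = just (suc (π i))

Swaps : ∀ l → (Maybe (Fin (2 + l)) → Maybe (Fin (2 + l))) → Set
Swaps l α = Class false (2 + l) 0 α × α (just zero) ≡ nothing × α nothing ≡ just zero

-- For `place π`, the points `nothing`, `just zero`, the end of the line and the preimage of that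
-- end are bad for every `π`. At any other point goodness is a succession of `π`.
card-linear-base : ∀ l → Card (Pt→ (2 + l)) (Swaps l) (Snum (suc l))
card-linear-base l = card-image {S = Fin→ (suc l) (suc l)} {T = Pt→ (2 + l)} place
  (λ e → λ { nothing → refl ; (just zero) → refl ; (just (suc i)) → cong (just ∘ suc) (e i) })
  (λ {π} (p , s) → mkClass (place-injective p) (card-∅ (setoid _) (λ {x} → bad s x)) moves , refl , refl)
  (λ _ _ e i → Fin.suc-injective (Maybe.just-injective (e (just (suc i)))))
  surj
  (card-Snum (suc l))
  where
  place-injective : ∀ {π} → IsPerm π → Inj (place {l} π)
  place-injective p {nothing}      {nothing}      e = refl
  place-injective p {nothing}      {just (suc j)} ()
  place-injective p {just zero}    {just zero}    e = refl
  place-injective p {just (suc i)} {nothing}      ()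
  place-injective p {just (suc i)} {just (suc j)} e =
    cong (just ∘ suc) (p i j (Fin.suc-injective (Maybe.just-injective e)))

  bad : ∀ {π} → NoSuccession π → ∀ x → ¬ Good (β⁺ (2 + l)) (place {l} π) x
  bad {π} s (just (suc i)) g with cyc i in eq | cyc (π i) in eq′
  bad {π} s (just (suc i)) () | zero  | _
  bad {π} s (just (suc i)) g | suc j | suc j′ with toℕ-cyc i | toℕ-cyc (π i)
  ... | inj₁ e | inj₁ e′ = s i (suc j) (trans (cong toℕ (sym eq)) e)
                             (trans (cong toℕ (Fin.suc-injective (Maybe.just-injective g)))
                               (trans (cong toℕ (sym eq′)) e′))
  ... | inj₁ _ | inj₂ (_ , e) with () ← trans (cong toℕ (sym eq′)) e
  bad {π} s (just (suc i)) g | suc j | suc j′ | inj₂ (_ , e) | _ with () ← trans (cong toℕ (sym eq)) e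

  surj : ∀ {α} → Swaps l α → ∃ λ π → (IsPerm π × NoSuccession π) × place π ≗ α
  surj {α} (cl , α0 , α∞) = π , (perm , nosucc) , λ
    { nothing → sym α∞ ; (just zero) → sym α0 ; (just (suc i)) → sym (α-suc i) }
    where
    strip : Maybe (Fin (2 + l)) → Fin (suc l)
    strip (just (suc j)) = j
    -- A default never taken: by injectivity, the values `nothing` and `just zero` are used up at
    -- `just zero` and `nothing`.
    strip _              = zero
    π : Fin (suc l) → Fin (suc l)
    π i = strip (α (just (suc i)))
    α-suc : ∀ i → α (just (suc i)) ≡ just (suc (π i))
    α-suc i with α (just (suc i)) in eq
    ... | nothing with () ← inj cl (trans eq (sym α0))
    ... | just zero with () ← inj cl (trans eq (sym α∞))
    ... | just (suc j) = refl
    perm : IsPerm π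
    perm i j e = Fin.suc-injective (Maybe.just-injective
      (inj cl (trans (α-suc i) (trans (cong (just ∘ suc) e) (sym (α-suc j))))))
    nosucc : NoSuccession π
    nosucc i zero     () _
    nosucc i (suc i′) p q = card-0 (setoid _) (goods cl) {just (suc i)} (begin
      α (just (skip (cyc i)))                 ≡⟨ cong (α ∘ just ∘ skip) (cyc-suc p) ⟩
      α (just (suc (suc i′)))                 ≡⟨ α-suc (suc i′) ⟩
      just (suc (π (suc i′)))                 ≡⟨ cong just (sym (skip-suc (π (suc i′)) q)) ⟩
      just (skip (π (suc i′)))                ≡⟨ cong (just ∘ skip) (cyc-suc q) ⟨
      just (skip (cyc (π i)))                 ≡⟨ cong (β⁺ (2 + l)) (α-suc i) ⟨
      β⁺ (2 + l) (α (just (suc i)))           ∎)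
      where
      skip-suc : ∀ {n} (j : Fin (suc l)) → toℕ j ≡ suc n → skip j ≡ suc j
      skip-suc (suc j) _ = refl

-- Each `α` determines one pair of the preimage `v` of `nothing` and the image `u` of `nothing`.
-- Independent rotations of source and target carry any pair to `(zero , zero)`, so all fibres have
-- the size of `Swaps`.
count-linear-base : ∀ {l z} → Card (Pt→ (2 + l)) (Class false (2 + l) 0) z →
                    z ≡ (2 + l) * (2 + l) * Snum (suc l)
count-linear-base {l} {z} c = trans (sym (ℕ.*-identityʳ z))
  (double-count {S = Pt→ (2 + l)} {T = setoid (Fin (2 + l) × Fin (2 + l))}
    {R = λ α (v , u) → Class false (2 + l) 0 α × α (just v) ≡ nothing × α nothing ≡ just u}
    (λ e (c , p , q) → class-resp e c , trans (sym (e _)) p , trans (sym (e _)) q)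
    (λ { refl r → r })
    (λ (c , _) → c , tt)
    c
    (λ {α} c → let v , p = false-hits c ; u , q = just-ends (ends c) in
       card-singleton (setoid _) (c , p , q) λ { {v′ , u′} (_ , p′ , q′) → cong₂ _,_
         (Maybe.just-injective (inj c (trans p (sym p′)))) (Maybe.just-injective (trans (sym q) q′)) })
    (card-Fin² (2 + l))
    λ { {v , u} _ → card-conj (rotation u) (rotation v)
      (λ {α} (c , p , q) → class-rotate u v c
        , cong (to (rotation u)) (trans (cong α (rotation-from v)) p)
        , trans (cong (to (rotation u)) q) (rotation-to u))
      (λ {α} (c , p , q) → class-unrotate u v c
        , cong (from (rotation u)) (trans (cong α (rotation-to v)) p)
        , trans (cong (from (rotation u)) q) (rotation-from u))
      (card-linear-base l) })
  where
  just-ends : ∀ {m} {x : Maybe (Fin m)} → Ends false x → ∃ λ u → x ≡ just u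
  just-ends (moves {u}) = u , refl

-- Existence of the counts

-- With identities as self-maps an `Iso` is a plain bijection, so `card-conj` can transport the
-- enumeration of all functions.
Fin-Iso : ∀ m → Iso {Fin (suc m)} {Maybe (Fin m)} id id
Fin-Iso m = record
  { to = λ { zero → nothing ; (suc i) → just i }
  ; from = λ { nothing → zero ; (just i) → suc i }
  ; from-to = λ { zero → refl ; (suc i) → refl }
  ; to-from = λ { nothing → refl ; (just i) → refl }
  ; commutes = λ _ → refl }

card-Pt→ : ∀ m → ∃ (Card (Pt→ m) (λ _ → ⊤))
card-Pt→ m = _ , card-conj (Fin-Iso m) (Fin-Iso m) {Φ = λ _ → ⊤} (λ _ → tt) (λ _ → tt)
  (card-countFuns {suc m} {λ _ → ⊤} (λ _ → yes tt) (λ _ _ → tt))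

class-exists : ∀ ε m g → ∃ (Card (Pt→ m) (Class ε m g))
class-exists ε m g =
  let z , c = card-filter (proj₂ (card-Pt→ m)) class-resp (λ {α} _ → class? α)
  in z , card-⇔ (Pt→ m) proj₂ (tt ,_) c

rooted-exists : ∀ ε m g → ∃ (Card (Pt→ (suc m)) (Rooted ε m g))
rooted-exists ε m g = card-filter (proj₂ (class-exists ε (suc m) g)) (λ e q → trans (sym (e _)) q)
  (λ {α} _ → α (just zero) ≟ᴹ just zero)

-- Solving the recurrences

-- Induction with Pascal's rule. The identity turns the factors of both recurrences into binomial
-- coefficients.
absorption : ∀ n h → suc h * (suc n C suc h) ≡ suc n * (n C h)
absorption n       zero    = trans (ℕ.*-identityˡ _) (trans (nC1≡n (suc n)) (sym (ℕ.*-identityʳ (suc n))))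
absorption zero    (suc h) = trans (cong (suc (suc h) *_) (k>n⇒nCk≡0 {1} {suc (suc h)} (s≤s (s≤s z≤n))))
                               (trans (ℕ.*-zeroʳ (suc (suc h))) (sym (cong (1 *_) (k>n⇒nCk≡0 {0} {suc h} (s≤s z≤n)))))
absorption (suc n) (suc h) = begin
  (2 + h) * (suc (suc n) C suc (suc h))  ≡⟨ cong ((2 + h) *_) (nCk+nC[k+1]≡[n+1]C[k+1] (suc n) (suc h)) ⟨
  (2 + h) * (a + b)                      ≡⟨ rearrange h a b ⟩
  a + (suc h * a + (2 + h) * b)          ≡⟨ cong (λ y → a + y) (cong₂ _+_ (absorption n h) (absorption n (suc h))) ⟩
  a + (suc n * (n C h) + suc n * (n C suc h))  ≡⟨ cong (λ y → a + y) (ℕ.*-distribˡ-+ (suc n) (n C h) _) ⟨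
  a + suc n * (n C h + n C suc h)        ≡⟨ cong (λ x → a + suc n * x) (nCk+nC[k+1]≡[n+1]C[k+1] n h) ⟩
  a + suc n * a                          ∎
  where
  a = suc n C suc h
  b = suc n C suc (suc h)
  rearrange : ∀ h a b → (2 + h) * (a + b) ≡ a + (suc h * a + (2 + h) * b)
  rearrange = solve-∀

count-class : ∀ {m g z t} → Card (Pt→ (suc m)) (Class true (suc m) g) z →
              Card (Pt→ (suc m)) (Rooted true m g) t → z ≡ suc m * t
count-class {m} {z = z} {t} cz ct = ℕ.*-cancelʳ-≡ z _ (suc m) (begin
  z * suc m              ≡⟨ class-rooted cz ct ⟩
  suc m * suc m * t      ≡⟨ ℕ.*-assoc (suc m) (suc m) t ⟩
  suc m * (suc m * t)    ≡⟨ ℕ.*-comm (suc m) (suc m * t) ⟩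
  suc m * t * suc m      ∎)

-- Eliminates the unrooted count from the two double counts. The cycle length and the number of good
-- points both grow by one, so the number of bad points stays the same.
rooted-step : ∀ {m h t t′} → Card (Pt→ (suc m)) (Rooted true m (suc h)) t →
              Card (Pt→ (2 + m)) (Rooted true (suc m) (2 + h)) t′ → t′ * suc h ≡ (2 + m) * t
rooted-step {m} {h} {t} {t′} c c′ = ℕ.*-cancelˡ-≡ _ _ (2 + m) (begin
  (2 + m) * (t′ * suc h)    ≡⟨ ℕ.*-assoc (2 + m) t′ (suc h) ⟨
  (2 + m) * t′ * suc h      ≡⟨ cong (_* suc h) (count-class cz c′) ⟨
  z * suc h                 ≡⟨ class-good cz c ⟩
  (2 + m) * (2 + m) * t     ≡⟨ ℕ.*-assoc (2 + m) (2 + m) t ⟩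
  (2 + m) * ((2 + m) * t)   ∎)
  where
  z = proj₁ (class-exists true (2 + m) (2 + h))
  cz = proj₂ (class-exists true (2 + m) (2 + h))

-- There are `suc k` bad points throughout, and `h` is the number of good points on the cycle; at
-- `h = 0` every point of the cycle is bad.
count-rooted : ∀ k h {t} → Card (Pt→ (suc (h + k))) (Rooted true (h + k) (suc h)) t →
               t ≡ ((h + suc k) C h) * Cnum (suc k)
count-rooted k zero    c = trans (card-unique (Pt→ (suc k)) c (card-cyclic-base k)) (sym (ℕ.*-identityˡ _))
count-rooted k (suc h) {t′} c′ = ℕ.*-cancelʳ-≡ t′ _ (suc h) (begin
  t′ * suc h                                     ≡⟨ rooted-step ct c′ ⟩
  (2 + (h + k)) * t                              ≡⟨ cong₂ (λ x y → suc x * y) (sym (ℕ.+-suc h k)) (count-rooted k h ct) ⟩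
  suc (h + suc k) * (((h + suc k) C h) * N)      ≡⟨ ℕ.*-assoc (suc (h + suc k)) ((h + suc k) C h) N ⟨
  suc (h + suc k) * ((h + suc k) C h) * N        ≡⟨ cong (_* N) (absorption (h + suc k) h) ⟨
  suc h * (suc (h + suc k) C suc h) * N          ≡⟨ ℕ.*-assoc (suc h) (suc (h + suc k) C suc h) N ⟩
  suc h * ((suc (h + suc k) C suc h) * N)        ≡⟨ ℕ.*-comm (suc h) _ ⟩
  (suc (h + suc k) C suc h) * N * suc h          ∎)
  where
  N = Cnum (suc k)
  t = proj₁ (rooted-exists true (h + k) (suc h))
  ct = proj₂ (rooted-exists true (h + k) (suc h))

-- The case without bad points, where the recurrence starts from the identity on a cycle of length
-- one.
count-rooted-0 : ∀ h {t} → Card (Pt→ (suc h)) (Rooted true h (2 + h)) t → t ≡ 1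
count-rooted-0 zero c = card-unique (Pt→ 1) c (card-singleton (Pt→ 1) {x = id}
  (mkClass id (card-⇔ (setoid _) (λ _ → refl) (λ _ → tt) (card-Pt 1)) fixes , refl)
  (λ { (cl , _) nothing → sym (ends-true (ends cl)) ; (_ , q) (just zero) → sym q }))
count-rooted-0 (suc h) {t′} c′ = ℕ.*-cancelʳ-≡ t′ 1 (2 + h) (begin
  t′ * (2 + h)  ≡⟨ rooted-step ct c′ ⟩
  (2 + h) * t   ≡⟨ cong ((2 + h) *_) (count-rooted-0 h ct) ⟩
  (2 + h) * 1   ≡⟨ ℕ.*-comm (2 + h) 1 ⟩
  1 * (2 + h)   ∎)
  where
  t = proj₁ (rooted-exists true h (2 + h))
  ct = proj₂ (rooted-exists true h (2 + h))

difference : ∀ {k m} → k ≤ m → ∃ λ h → h + k ≡ m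
difference {k} k≤m = let h , e = ℕ.m≤n⇒∃[o]m+o≡n k≤m in h , trans (ℕ.+-comm h k) e

count-fixing : ∀ {m k z} → k ≤ 2 + m → Card (Pt→ (suc m)) (Class true (suc m) (2 + m ∸ k)) z →
               z ≡ suc m * (suc m C k) * Cnum k
count-fixing {m} {k} {z} k≤ c with ℕ.m≤n⇒m<n∨m≡n k≤
-- Here all points would be bad, but `nothing` is good; the binomial coefficient vanishes as well.
... | inj₂ refl = begin
  z                                            ≡⟨ card-unique (Pt→ _) c (card-∅ (Pt→ _) (none (ℕ.n∸n≡0 m))) ⟩
  0                                            ≡⟨⟩
  0 * Cnum (2 + m)                             ≡⟨ cong (_* Cnum (2 + m)) (ℕ.*-zeroʳ (suc m)) ⟨
  suc m * 0 * Cnum (2 + m)                     ≡⟨ cong (λ x → suc m * x * Cnum (2 + m)) (k>n⇒nCk≡0 (ℕ.n<1+n (suc m))) ⟨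
  suc m * (suc m C (2 + m)) * Cnum (2 + m)     ∎
  where
  none : ∀ {g α} → g ≡ 0 → ¬ Class true (suc m) g α
  none refl cl = card-0 (setoid _) (goods cl) (good-nothing cl)
count-fixing {m} {zero} {z} _ c | inj₁ _ = begin
  z                                ≡⟨ count-class c ct ⟩
  suc m * t                        ≡⟨ cong (suc m *_) (count-rooted-0 m ct) ⟩
  suc m * 1                        ≡⟨ ℕ.*-identityʳ _ ⟨
  suc m * 1 * 1                    ∎
  where
  t = proj₁ (rooted-exists true m (2 + m))
  ct = proj₂ (rooted-exists true m (2 + m))
count-fixing {m} {suc k} {z} _ c | inj₁ (s≤s (s≤s k≤m)) with h , refl ← difference k≤m = begin
  z                                                    ≡⟨ count-class c′ ct ⟩
  suc m * t                                            ≡⟨ cong (suc m *_) (count-rooted k h ct) ⟩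
  suc m * (((h + suc k) C h) * Cnum (suc k))           ≡⟨ ℕ.*-assoc (suc m) ((h + suc k) C h) (Cnum (suc k)) ⟨
  suc m * ((h + suc k) C h) * Cnum (suc k)             ≡⟨ cong (λ x → suc m * x * Cnum (suc k)) binomial ⟩
  suc m * (suc (h + k) C suc k) * Cnum (suc k)         ∎
  where
  t = proj₁ (rooted-exists true m (suc h))
  ct = proj₂ (rooted-exists true m (suc h))
  g≡ : suc (h + k) ∸ k ≡ suc h
  g≡ = trans (ℕ.+-∸-assoc 1 {h + k} {k} k≤m) (cong suc (ℕ.m+n∸n≡m h k))
  c′ = subst (λ g → Card (Pt→ (suc m)) (Class true (suc m) g) z) g≡ c
  binomial : (h + suc k) C h ≡ suc (h + k) C suc k
  binomial = trans (nCk≡nC[n∸k] (ℕ.m≤m+n h (suc k))) (cong₂ _C_ (ℕ.+-suc h k) (ℕ.m+n∸m≡n h (suc k)))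

-- Here n is `3 + (h + j)` and k is `3 + j`. Induction on the number `h` of good points:
-- `class-good` passes to the rooted count on a shorter cycle, and `class-rooted` from there to the
-- class on that cycle.
count-moving-≥3 : ∀ j h {z} → Card (Pt→ (2 + (h + j))) (Class false (2 + (h + j)) h) z →
               z ≡ (2 + (h + j)) * (2 + (h + j)) * (((h + j) C h) * Snum (suc j))
count-moving-≥3 j zero    c = trans (count-linear-base c) (cong ((2 + j) * (2 + j) *_) (sym (ℕ.*-identityˡ (Snum (suc j)))))
count-moving-≥3 j (suc h) {z′} c′ = ℕ.*-cancelʳ-≡ z′ _ (suc h) (begin
  z′ * suc h                                   ≡⟨ class-good c′ cr ⟩
  suc M * suc M * t                            ≡⟨ cong (suc M * suc M *_) t≡ ⟩
  suc M * suc M * (B * S * suc (h + j))        ≡⟨ cong (suc M * suc M *_) (rearrange B S (suc (h + j))) ⟩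
  suc M * suc M * (suc (h + j) * B * S)        ≡⟨ cong (λ x → suc M * suc M * (x * S)) (absorption (h + j) h) ⟨
  suc M * suc M * (suc h * B′ * S)             ≡⟨ rearrange′ (suc M * suc M) (suc h) B′ S ⟩
  suc M * suc M * (B′ * S) * suc h             ∎)
  where
  M = 2 + (h + j)
  S = Snum (suc j)
  B = (h + j) C h
  B′ = suc (h + j) C suc h
  z = proj₁ (class-exists false M h)
  cz = proj₂ (class-exists false M h)
  t = proj₁ (rooted-exists false (suc (h + j)) h)
  cr = proj₂ (rooted-exists false (suc (h + j)) h)
  rearrange : ∀ b s n → b * s * n ≡ n * b * s
  rearrange = solve-∀
  rearrange′ : ∀ q h b s → q * (h * b * s) ≡ q * (b * s) * h
  rearrange′ = solve-∀
  t≡ : t ≡ B * S * suc (h + j)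
  t≡ = ℕ.*-cancelˡ-≡ t _ (M * M) (begin
    M * M * t                          ≡⟨ class-rooted cz cr ⟨
    z * suc (h + j)                    ≡⟨ cong (_* suc (h + j)) (count-moving-≥3 j h cz) ⟩
    M * M * (B * S) * suc (h + j)      ≡⟨ ℕ.*-assoc (M * M) (B * S) _ ⟩
    M * M * (B * S * suc (h + j))      ∎)

-- With n equal to `3 + m`, the bound on `g` says k is at most 2. Descent through both double counts
-- ends at a cycle of length one, where `moved false 0` is 0 and forces the rooted count to vanish.
count-moving-≤2 : ∀ m {g z} → suc m ≤ g → Card (Pt→ (2 + m)) (Class false (2 + m) g) z → z ≡ 0
count-moving-≤2 m {suc g} {z} (s≤s m≤g) c = ℕ.m*n≡0⇒m≡0 z (suc g) (begin
  z * suc g                ≡⟨ class-good {g = g} c cr ⟩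
  (2 + m) * (2 + m) * t    ≡⟨ cong ((2 + m) * (2 + m) *_) t≡0 ⟩
  (2 + m) * (2 + m) * 0    ≡⟨ ℕ.*-zeroʳ ((2 + m) * (2 + m)) ⟩
  0                        ∎)
  where
  z₀ = proj₁ (class-exists false (suc m) g)
  c₀ = proj₂ (class-exists false (suc m) g)
  t = proj₁ (rooted-exists false m g)
  cr = proj₂ (rooted-exists false m g)
  vanish : ∀ m {z} → m ≤ g → Card (Pt→ (suc m)) (Class false (suc m) g) z → z * m ≡ 0
  vanish zero    {z} _   _ = ℕ.*-zeroʳ z
  vanish (suc m)     m<g c = cong (_* suc m) (count-moving-≤2 m m<g c)
  t≡0 : t ≡ 0
  t≡0 = ℕ.m*n≡0⇒m≡0 t (suc m * suc m)
    (trans (ℕ.*-comm t _) (trans (sym (class-rooted c₀ cr)) (vanish m m≤g c₀)))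

-- Relabelling an (n-1)-cycle

module _ {n : ℕ} {β : Fin n → Fin n} (β-perm : IsPerm β) where

  iter-injective : ∀ t {x y} → iter β t x ≡ iter β t y → x ≡ y
  iter-injective zero    e = e
  iter-injective (suc t) e = iter-injective t (β-perm _ _ e)

  iter-cancel : ∀ {s t x} → s ≤ t → iter β s x ≡ iter β t x → iter β (t ∸ s) x ≡ x
  iter-cancel {s} {t} {x} s≤t e = sym (iter-injective s (begin
    iter β s x                   ≡⟨ e ⟩
    iter β t x                   ≡⟨ cong (λ u → iter β u x) (ℕ.m+[n∸m]≡n s≤t) ⟨
    iter β (s + (t ∸ s)) x       ≡⟨ iter-+ β s (t ∸ s) x ⟩
    iter β s (iter β (t ∸ s) x)  ∎))

module _ {n : ℕ} (β : Fin n → Fin n) where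

  iter-multiple : ∀ d q {x} → iter β d x ≡ x → iter β (q * d) x ≡ x
  iter-multiple d zero        e = refl
  iter-multiple d (suc q) {x} e = trans (iter-+ β d (q * d) x) (trans (cong (iter β d) (iter-multiple d q e)) e)

  iter-mod : ∀ d .{{_ : NonZero d}} t {x} → iter β d x ≡ x → iter β t x ≡ iter β (t % d) x
  iter-mod d t {x} e = begin
    iter β t x                                ≡⟨ cong (λ u → iter β u x) (m≡m%n+[m/n]*n t d) ⟩
    iter β (t % d + t / d * d) x              ≡⟨ iter-+ β (t % d) (t / d * d) x ⟩
    iter β (t % d) (iter β (t / d * d) x)     ≡⟨ cong (iter β (t % d)) (iter-multiple d (t / d) e) ⟩
    iter β (t % d) x                          ∎

module _ {m : ℕ} {β : Fin (2 + m) → Fin (2 + m)} (β-perm : IsPerm β) {p x : Fin (2 + m)} (βp : β p ≡ p)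
         (orbit : ∀ y → y ≢ p → ∃ λ j → iter β j x ≡ y) where

  private
    iter-p : ∀ t → iter β t p ≡ p
    iter-p zero    = refl
    iter-p (suc t) = trans (cong β (iter-p t)) βp

    other : ∀ p → ∃ λ (y : Fin (2 + m)) → y ≢ p
    other zero    = suc zero , λ ()
    other (suc p) = zero , λ ()

    -- If the orbit met the fixed point `p`, cancelling powers of `β` would give `x ≡ p`, and then
    -- the orbit could not reach any other point.
    orbit-≢p : ∀ t → p ≢ iter β t x
    orbit-≢p t e = let y , y≢p = other p ; j , q = orbit y y≢p in
      y≢p (trans (sym q) (trans (cong (iter β j) x≡p) (iter-p j)))
      where
      x≡p : x ≡ p
      x≡p = iter-injective β-perm t (trans (sym e) (sym (iter-p t)))

    -- Exponents matter only modulo `d`, so the `suc m` points other than `p` inject into the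
    -- residues.
    n-1≤period : ∀ d .{{_ : NonZero d}} → iter β d x ≡ x → suc m ≤ d
    n-1≤period d e = Fin.injective⇒≤ {f = λ i → fromℕ< (m%n<n (t i) d)} λ {i} {j} q →
      Fin.punchIn-injective p i j (trans (sym (reach i)) (trans
        (cong (λ u → iter β u x) (trans (sym (Fin.toℕ-fromℕ< (m%n<n (t i) d)))
          (trans (cong toℕ q) (Fin.toℕ-fromℕ< (m%n<n (t j) d)))))
        (reach j)))
      where
      t : Fin (suc m) → ℕ
      t i = proj₁ (orbit (punchIn p i) (Fin.punchInᵢ≢i p i))
      reach : ∀ i → iter β (t i % d) x ≡ punchIn p i
      reach i = trans (sym (iter-mod β d (t i) e)) (proj₂ (orbit (punchIn p i) (Fin.punchInᵢ≢i p i)))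

    -- The iterates with exponents 0 to `suc m` all avoid `p`, so two of them coincide; this gives a
    -- period of at most `suc m`, and `n-1≤period` is the reverse bound.
    period : iter β (suc m) x ≡ x
    period with i , j , i<j , e ← Fin.pigeonhole (ℕ.n<1+n (suc m)) (λ (i : Fin (2 + m)) → punchOut (orbit-≢p (toℕ i))) =
      subst (λ d → iter β d x ≡ x) (ℕ.≤-antisym d≤ (n-1≤period _ {{ℕ.>-nonZero (ℕ.m<n⇒0<n∸m i<j)}} loop)) loop
      where
      loop : iter β (toℕ j ∸ toℕ i) x ≡ x
      loop = iter-cancel β-perm (ℕ.<⇒≤ i<j) (Fin.punchOut-injective (orbit-≢p (toℕ i)) (orbit-≢p (toℕ j)) e)
      d≤ : toℕ j ∸ toℕ i ≤ suc m
      d≤ = ℕ.≤-trans (ℕ.m∸n≤m (toℕ j) (toℕ i)) (ℕ.≤-pred (Fin.toℕ<n j))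

    label : Maybe (Fin (suc m)) → Fin (2 + m)
    label nothing  = p
    label (just i) = iter β (toℕ i) x

    unlabel : ∀ y → ∃ λ a → label a ≡ y
    unlabel y with y Fin.≟ p
    ... | yes refl = nothing , refl
    ... | no y≢p   = just (fromℕ< (m%n<n j (suc m))) , (begin
      iter β (toℕ (fromℕ< (m%n<n j (suc m)))) x  ≡⟨ cong (λ u → iter β u x) (Fin.toℕ-fromℕ< (m%n<n j (suc m))) ⟩
      iter β (j % suc m) x                       ≡⟨ iter-mod β (suc m) j period ⟨
      iter β j x                                 ≡⟨ proj₂ (orbit y y≢p) ⟩
      y                                          ∎)
      where j = proj₁ (orbit y y≢p)

    label-injective : ∀ {a b} → label a ≡ label b → a ≡ b
    label-injective e = surjective⇒injective (card-Pt (suc m)) {f = to (Fin-Iso (suc m)) ∘ label}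
      (λ b → let a , q = unlabel (from (Fin-Iso (suc m)) b) in a ,
         trans (cong (to (Fin-Iso (suc m))) q) (to-from (Fin-Iso (suc m)) b))
      (cong (to (Fin-Iso (suc m))) e)

  label-Iso : Iso (β⁺ (suc m)) β
  label-Iso = record
    { to = label
    ; from = proj₁ ∘ unlabel
    ; from-to = λ a → label-injective (proj₂ (unlabel (label a)))
    ; to-from = proj₂ ∘ unlabel
    ; commutes = λ { nothing → sym βp ; (just i) → step i } }
    where
    step : ∀ i → iter β (toℕ (cyc i)) x ≡ β (iter β (toℕ i) x)
    step i with toℕ-cyc i
    ... | inj₁ e        = cong (λ u → iter β u x) e
    ... | inj₂ (e , e′) = trans (cong (λ u → iter β u x) e′)
                            (trans (sym period) (cong (λ u → iter β u x) (sym e)))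

-- Hamming distance as the number of bad points

module _ {n : ℕ} {β : Fin n → Fin n} where

  card-bad : ∀ α → Card (setoid (Fin n)) (λ a → ¬ Good β α a) (hamming (α ∘ β) (β ∘ α))
  card-bad α = card-Fin? λ a → ¬? (α (β a) Fin.≟ β (α a))

  goods+hamming : ∀ {α g} → Goods β α g → g + hamming (α ∘ β) (β ∘ α) ≡ n
  goods+hamming {α} c = card-unique (setoid _)
    (card-⇔ (setoid _) (λ _ → tt) (λ {a} _ → Dec.toSum (α (β a) Fin.≟ β (α a)))
      (card-⊎ (setoid _) c (card-bad α) (λ { p ¬p refl → ¬p p })))
    (card-Fin n)

  kCommute⇒goods : ∀ {α k} → KCommute k α β → Goods β α (n ∸ k)
  kCommute⇒goods {α} {k} refl = subst (Goods β α) g≡ c′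
    where
    c′ = card-Fin? λ a → α (β a) Fin.≟ β (α a)
    g≡ = trans (sym (ℕ.m+n∸n≡m _ k)) (cong (_∸ k) (goods+hamming {α} c′))

  goods⇒kCommute : ∀ {α k} → k ≤ n → Goods β α (n ∸ k) → KCommute k α β
  goods⇒kCommute {α} {k} k≤n c = ℕ.+-cancelˡ-≡ (n ∸ k) _ _
    (trans (goods+hamming {α} c) (sym (ℕ.m∸n+n≡m k≤n)))

  kCommute-resp : ∀ {k} → (λ α → KCommute k α β) Respects _≗_
  kCommute-resp {_} {α} {α′} e refl = card-unique (setoid _) (card-bad α′)
    (card-⇔ (setoid _)
      (λ {x} → _∘ good-resp {β = β} {α′} {α} (sym ∘ e))
      (λ {x} → _∘ good-resp {β = β} {α} {α′} e)
      (card-bad α))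

  card-c : ∀ k → Card (Fin→ n n) (λ α → IsPerm α × KCommute k α β) (c k β)
  card-c k = card-countFuns _ λ {α} {α′} e (p , q) → perm-resp e p , kCommute-resp {k} {α} {α′} e q

-- Splitting by the image of the fixed point

Commuting : (m g : ℕ) → (Maybe (Fin m) → Maybe (Fin m)) → Set
Commuting m g α = Inj α × Goods (β⁺ m) α g

-- Relabelling preserves the number of good points; `k ≤ suc m` makes the truncated subtraction
-- exact, so that this number determines `k`.
card-relabel : ∀ {m k} {β : Fin (suc m) → Fin (suc m)} → Iso (β⁺ m) β → k ≤ suc m →
               Card (Pt→ m) (Commuting m (suc m ∸ k)) (c k β)
card-relabel {m} {k} {β} s k≤ = card-conj (Iso-sym s) (Iso-sym s)
  {Φ = λ α → IsPerm α × KCommute k α β} {Ψ = Commuting m (suc m ∸ k)}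
  (λ {α} (p , q) → conj-injective (Iso-sym s) (Iso-sym s) {α} (λ {x} {y} → p x y)
                 , goods-conj (Iso-sym s) (Iso-sym s) {α} (kCommute⇒goods {α = α} q))
  (λ {α} (i , g) → let s⁻⁻ = Iso-sym (Iso-sym s) in
      (λ _ _ → conj-injective s⁻⁻ s⁻⁻ {α} i)
    , goods⇒kCommute {β = β} {conj s⁻⁻ s⁻⁻ α} k≤ (goods-conj s⁻⁻ s⁻⁻ {α} g))
  (card-c k)

card-commuting : ∀ {m g z} → Card (Pt→ m) (Commuting m g) z →
                 ∃₂ λ z₁ z₂ → Card (Pt→ m) (Class true m g) z₁ ×
                   Card (Pt→ m) (Class false m g) z₂ × z ≡ z₁ + z₂
card-commuting {m} {g} cz =
  let z₁ , z₂ , c₁ , c₂ , e = card-split {Q = λ α → Ends true (α nothing)} cz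
        (λ e → subst (Ends true) (e nothing)) (λ {α} _ → ends? true (α nothing))
  in z₁ , z₂
   , card-⇔ (Pt→ m) (λ (p , e) → toClass p e) (λ cl → fromClass cl , ends cl) c₁
   , card-⇔ (Pt→ m) (λ (p , ¬e) → toClass p (not-fixes ¬e))
       (λ cl → fromClass cl , fixes-not (ends cl)) c₂
   , e
  where
  toClass : ∀ {ε α} → Commuting m g α → Ends ε (α nothing) → Class ε m g α
  toClass (i , g) e = mkClass i g e
  fromClass : ∀ {ε α} → Class ε m g α → Commuting m g α
  fromClass (mkClass i g _) = i , g
  not-fixes : ∀ {x : Maybe (Fin m)} → ¬ Ends true x → Ends false x
  not-fixes {nothing} ¬e = contradiction fixes ¬e
  not-fixes {just u}  ¬e = moves
  fixes-not : ∀ {x : Maybe (Fin m)} → Ends false x → ¬ Ends true x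
  fixes-not moves ()

-- The two summands and their total

vanishes : ∀ m x → 0 ≡ (2 + m) ^ 2 * 0 * x
vanishes m x = sym (cong (_* x) (ℕ.*-zeroʳ ((2 + m) ^ 2)))

count-moving : ∀ m k {z} → k ≤ 3 + m → Card (Pt→ (2 + m)) (Class false (2 + m) (3 + m ∸ k)) z →
               z ≡ (2 + m) ^ 2 * binom m ((+ k) -ℤ (+ 3)) * Snum (k ∸ 2)
-- For k at most 2 the lower index is negative, so `binom` computes to 0.
count-moving m 0 _ cz = trans (count-moving-≤2 m (ℕ.m≤n+m (suc m) 2) cz) (vanishes m (Snum 0))
count-moving m 1 _ cz = trans (count-moving-≤2 m (ℕ.m≤n+m (suc m) 1) cz) (vanishes m (Snum 0))
count-moving m 2 _ cz = trans (count-moving-≤2 m ℕ.≤-refl cz) (vanishes m (Snum 0))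
count-moving m (suc (suc (suc j))) {z} (s≤s (s≤s (s≤s j≤m))) cz with h , refl ← difference j≤m = begin
  z                                                        ≡⟨ count-moving-≥3 j h cz′ ⟩
  M * M * (((h + j) C h) * S)                              ≡⟨ cong (λ x → M * M * (x * S)) binomial ⟩
  M * M * (((h + j) C j) * S)                              ≡⟨ ℕ.*-assoc (M * M) ((h + j) C j) S ⟨
  -- The power `M ^ 2` unfolds to `M * (M * 1)`.
  M * M * ((h + j) C j) * S                                ≡⟨ cong (λ x → M * x * ((h + j) C j) * S) (ℕ.*-identityʳ M) ⟨
  M ^ 2 * ((h + j) C j) * S                                ∎
  where
  M = 2 + (h + j)
  S = Snum (suc j)
  cz′ = subst (λ g → Card (Pt→ M) (Class false M g) z) (ℕ.m+n∸n≡m h j) cz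
  binomial : (h + j) C h ≡ (h + j) C j
  binomial = trans (nCk≡nC[n∸k] (ℕ.m≤m+n h j)) (cong ((h + j) C_) (ℕ.m+n∸m≡n h j))

theorem3p5 : (n : ℕ) → 4 ≤ n → (β : Fin n → Fin n) → IsPerm β → IsNm1Cycle β →
    (k : ℕ) → k ≤ n →
    c k β ≡ (n ∸ 1) * ((n ∸ 1) C k) * Cnum k
    + (n ∸ 1) ^ 2 * binom (n ∸ 3) ((+ k) -ℤ (+ 3)) * Snum (k ∸ 2)
theorem3p5 1 (s≤s ())
theorem3p5 2 (s≤s (s≤s ()))
theorem3p5 (suc (suc (suc m))) (s≤s (s≤s (s≤s _))) β β-perm (p , βp , x , orbit) k k≤n =
  let z₁ , z₂ , c₁ , c₂ , e = card-commuting (card-relabel (label-Iso β-perm βp orbit) k≤n)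
  in trans e (cong₂ _+_ (count-fixing k≤n c₁) (count-moving m k k≤n c₂))
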